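{- For every integer $h'\geq 1$ there exists an integer $\nu=\nu(h')\geq 1$ with the following property. Let $G$ be a connected graph with no clique of cardinality $h'$. Let $S'\subseteq V(G)$ be such that $|S'|\geq\nu$, $G\setminus S'$ is connected, and every vertex of $S'$ has a neighbor in $G\setminus S'$. Then there is a set $\tilde S\subseteq S'$ with $|\tilde S|=h'$ and an induced subgraph $H'$ of $G\setminus S'$ for which one of the following holds: (i) $H'$ is a path and every vertex of $\tilde S$ has a neighbor in $H'$; or (ii) $H'$ is a caterpillar, or the line graph of a caterpillar, or a subdivided star; moreover every vertex of $\tilde S$ has a unique neighbor in $H'$, and $V(H')\cap N(\tilde S)=\mathcal{Z}(H')$.
   Context: Graphs are finite and simple; a path is an induced path. A branch vertex is a vertex of degree more than two. A caterpillar is a tree of maximum degree three such that some path of it contains all its branch vertices. A subdivided star is a graph isomorphic to a subdivision of $K_{1,\delta}$ for some $\delta\geq 3$. A vertex of a graph $H$ is simplicial if its neighborhood in $H$ is a clique; $\mathcal{Z}(H)$ denotes the set of simplicial vertices of $H$. For a set $X$, $N(X)$ is the set of vertices not in $X$ having a neighbor in $X$. -}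

module Defs where

open import Data.Nat using (ℕ; zero; suc; _≤_; _<_)
open import Data.Fin using (Fin; zero; suc; toℕ; inject₁; fromℕ)
open import Data.Fin.Subset using (Subset; _∈_; _∉_; ∣_∣; ⊤)
open import Data.Vec using (tabulate)
open import Data.Bool using (Bool; true; false)
open import Data.Unit using (tt) renaming (⊤ to Unit)
open import Data.Product using (Σ; ∃; ∃-syntax; _×_; _,_; proj₁; proj₂)
open import Data.Sum using (_⊎_; inj₁; inj₂)
open import Relation.Nullary using (¬_)
open import Relation.Binary.PropositionalEquality using (_≡_; _≢_)
open import Function.Bundles using (_↔_; _⇔_; Inverse)

record Graph : Set where
  field
    n      : ℕ
    adj    : Fin n → Fin n → Bool
    sym    : ∀ u v → adj u v ≡ adj v u
    irrefl : ∀ v → adj v v ≡ false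

open Graph public

Adjacent : (G : Graph) → Fin (n G) → Fin (n G) → Set
Adjacent G u v = adj G u v ≡ true

Injective : {A B : Set} → (A → B) → Set
Injective f = ∀ x y → f x ≡ f y → x ≡ y

-- The induced subgraph of G on the image of f : Fin k → Fin n
-- (f is required to be injective wherever this is used).
induced : (G : Graph) (k : ℕ) → (Fin k → Fin (n G)) → Graph
induced G k f = record
  { n = k
  ; adj = λ i j → adj G (f i) (f j)
  ; sym = λ i j → sym G (f i) (f j)
  ; irrefl = λ i → irrefl G (f i)
  }

data Walk (G : Graph) (X : Subset (n G)) : Fin (n G) → Fin (n G) → Set where
  here : ∀ {u} → u ∈ X → Walk G X u u
  step : ∀ {u w v} → u ∈ X → Adjacent G u w → Walk G X w v → Walk G X u v

ConnectedOn : (G : Graph) → Subset (n G) → Set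
ConnectedOn G X = ∀ u v → u ∈ X → v ∈ X → Walk G X u v

Connected : Graph → Set
Connected G = ConnectedOn G ⊤

HasCycle : Graph → Set
HasCycle G = ∃[ k ] Σ (Fin (suc (suc (suc k))) → Fin (n G)) λ c →
  Injective c × (∀ (i : Fin (suc (suc k))) → Adjacent G (c (inject₁ i)) (c (suc i)))
  × Adjacent G (c (fromℕ (suc (suc k)))) (c zero)

Tree : Graph → Set
Tree G = Connected G × ¬ HasCycle G

neighbourhood : (G : Graph) → Fin (n G) → Subset (n G)
neighbourhood G v = tabulate (adj G v)

degree : (G : Graph) → Fin (n G) → ℕ
degree G v = ∣ neighbourhood G v ∣

PathAdj : {m : ℕ} → Fin m → Fin m → Set
PathAdj i j = suc (toℕ i) ≡ toℕ j ⊎ suc (toℕ j) ≡ toℕ i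

IsPath : Graph → Set
IsPath G = 1 ≤ n G × Σ (Fin (n G) ↔ Fin (n G)) λ φ →
  ∀ u v → Adjacent G u v ⇔ PathAdj (Inverse.to φ u) (Inverse.to φ v)

Caterpillar : Graph → Set
Caterpillar G = Tree G × (∀ v → degree G v ≤ 3) ×
  (∃[ k ] Σ (Fin k → Fin (n G)) λ f → Injective f × IsPath (induced G k f)
     × (∀ v → 2 < degree G v → ∃[ i ] f i ≡ v))

SharesEnd : {m : ℕ} → Fin m × Fin m → Fin m × Fin m → Set
SharesEnd (a , b) (c , d) = a ≡ c ⊎ a ≡ d ⊎ b ≡ c ⊎ b ≡ d

IsLineGraphOf : Graph → Graph → Set
IsLineGraphOf H T = Σ (Fin (n H) → Fin (n T) × Fin (n T)) λ e →
  (∀ i → toℕ (proj₁ (e i)) < toℕ (proj₂ (e i)) × Adjacent T (proj₁ (e i)) (proj₂ (e i)))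
  × Injective e
  × (∀ a b → toℕ a < toℕ b → Adjacent T a b → ∃[ i ] e i ≡ (a , b))
  × (∀ i j → Adjacent H i j ⇔ (i ≢ j × SharesEnd (e i) (e j)))

IsLineGraphOfCaterpillar : Graph → Set
IsLineGraphOfCaterpillar H = Σ Graph λ T → Caterpillar T × IsLineGraphOf H T

-- Subdivision of K_{1,δ}: a centre and δ legs, leg i having suc (ℓ i) vertices
-- (the edge of K_{1,δ} subdivided ℓ i times).
StarV : (δ : ℕ) → (Fin δ → ℕ) → Set
StarV δ ℓ = Unit ⊎ Σ (Fin δ) (λ i → Fin (suc (ℓ i)))

data StarAdj (δ : ℕ) (ℓ : Fin δ → ℕ) : StarV δ ℓ → StarV δ ℓ → Set where
  centre-leg : ∀ i → StarAdj δ ℓ (inj₁ tt) (inj₂ (i , zero))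
  leg-centre : ∀ i → StarAdj δ ℓ (inj₂ (i , zero)) (inj₁ tt)
  forward    : ∀ i (j : Fin (ℓ i)) → StarAdj δ ℓ (inj₂ (i , inject₁ j)) (inj₂ (i , suc j))
  backward   : ∀ i (j : Fin (ℓ i)) → StarAdj δ ℓ (inj₂ (i , suc j)) (inj₂ (i , inject₁ j))

IsSubdividedStar : Graph → Set
IsSubdividedStar G = ∃[ δ ] 3 ≤ δ × Σ (Fin δ → ℕ) λ ℓ → Σ (Fin (n G) ↔ StarV δ ℓ) λ φ →
  ∀ u v → Adjacent G u v ⇔ StarAdj δ ℓ (Inverse.to φ u) (Inverse.to φ v)

IsClique : (G : Graph) → Subset (n G) → Set
IsClique G K = ∀ u v → u ∈ K → v ∈ K → u ≢ v → Adjacent G u v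

HasCliqueOfSize : Graph → ℕ → Set
HasCliqueOfSize G h = Σ (Subset (n G)) λ K → ∣ K ∣ ≡ h × IsClique G K

Simplicial : (H : Graph) → Fin (n H) → Set
Simplicial H i = ∀ j k → Adjacent H i j → Adjacent H i k → j ≢ k → Adjacent H j k

Outcome : (G : Graph) → Subset (n G) → (k : ℕ) → (Fin k → Fin (n G)) → Set
Outcome G S̃ k f =
  (IsPath (induced G k f) × (∀ s → s ∈ S̃ → ∃[ i ] Adjacent G s (f i)))
  ⊎ ((Caterpillar (induced G k f) ⊎ IsLineGraphOfCaterpillar (induced G k f)
        ⊎ IsSubdividedStar (induced G k f))
     × (∀ s → s ∈ S̃ → ∃[ i ] (Adjacent G s (f i) × (∀ j → Adjacent G s (f j) → j ≡ i)))
     × (∀ i → (∃[ s ] (s ∈ S̃ × Adjacent G s (f i))) ⇔ Simplicial (induced G k f) i))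

{-# OPTIONS --safe #-}

-- Let H be a connected subgraph of G ∖ S′ that contains a root r, has a neighbour of every s ∈ S′,
-- and is minimal for this: for v ≠ r in H, the component R of r in H ∖ v misses the neighbours of
-- some s ∈ S′.  A shortest path outside R from v to a neighbour of s is a private leg hanging off
-- v (a "pendant"); pendants of vertices lying in each other's R are disjoint and anticomplete
-- except possibly for their first vertices.
--
-- Take the breadth-first tree of H from r.  If a vertex has many children then, by Ramsey and the
-- absence of an h-clique, h of them are pairwise nonadjacent, and their pendants form a subdivided
-- star.  Otherwise degrees in the tree are bounded, and descending into the heaviest subtree gives
-- a root path v₀ v₁ … on which many vertices vₖ either are the chosen contact of some s or have a
-- second child c.  Such a c can only see vₖ, vₖ₊₁ and vₖ₊₂ on the path.  After thinning out, h of
-- these vertices behave alike: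
--   * contacts: the path has h neighbours in S′;
--   * c sees only vₖ: the pendants are the legs of a caterpillar;
--   * c sees vₖ and vₖ₊₁ only: the pendants and the path form the line graph of a caterpillar;
--   * c sees vₖ₊₂: reroute the path through c instead of vₖ₊₁, so that c itself is a contact
--     (its pendant is trivial) or carries the rest of its pendant as a leg.

module Submission where

open import Defs
open import Data.Bool using (true; false; Bool)
import Data.Bool.Properties as Bool
open import Data.Empty using (⊥-elim)
open import Data.Fin using (Fin; zero; suc; toℕ; fromℕ; fromℕ<; inject₁; splitAt; _↑ˡ_; _↑ʳ_)
import Data.Fin.Properties as Fin
open import Data.Fin.Relation.Unary.Top using (view; ‵fromℕ; ‵inject₁)
open import Data.Fin.Subset using (Subset; _∈_; _∉_; ∣_∣; ⊥; _-_; inside; outside; _⊆_; ⁅_⁆; ⊤; _∩_; ∁)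
open import Data.Fin.Subset.Properties using (_∈?_; ∉⊥; ∣⊥∣≡0; x∈p∧x≢y⇒x∈p-y; p─⊥≡p; Empty-unique; ∣p∣≤n; x∈⁅x⁆; x∈⁅y⁆⇒x≡y; ∈⊤; x∈p∩q⁺; x∈p∩q⁻; x∈∁p⇒x∉p; x∉p⇒x∈∁p; p⊆q⇒∣p∣≤∣q∣; x∈p⇒∣p-x∣<∣p∣)
open import Data.List using (List; []; _∷_; length; filter; allFin; map; upTo)
open import Data.List.Membership.Propositional using (find) renaming (_∈_ to _∈ˡ_)
open import Data.List.Membership.Propositional.Properties using (∈-filter⁺; ∈-filter⁻; ∈-allFin; ∈-upTo⁺; ∈-upTo⁻)
open import Data.List.Properties using (length-map; length-upTo)
open import Data.List.Relation.Binary.Sublist.Propositional using ([]; _∷ʳ_; _∷_; minimum; ⊆-trans) renaming (_⊆_ to _⊑_; lookup to ⊑-∈)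
open import Data.List.Relation.Binary.Sublist.Propositional.Properties using (All-resp-⊆)
open import Data.List.Relation.Unary.All as All using (All; []; _∷_)
open import Data.List.Relation.Unary.All.Properties using (¬All⇒Any¬) renaming (map⁺ to All-map⁺)
open import Data.List.Relation.Unary.AllPairs as AllPairs using (AllPairs; []; _∷_)
open import Data.List.Relation.Unary.AllPairs.Properties using () renaming (map⁺ to AllPairs-map⁺)
open import Data.List.Relation.Unary.Any using (here; there)
open import Data.List.Relation.Unary.Unique.Propositional using (Unique)
import Data.List.Relation.Unary.Unique.Propositional.Properties as Unique
open import Data.Nat using (ℕ; zero; suc; _+_; _*_; _∸_; _≤_; _<_; z≤n; s≤s; _≤?_; _<?_)
open import Data.Nat.Induction using (<-wellFounded)
open import Data.Nat.Properties
open import Data.Product using (Σ; ∃; ∃-syntax; _×_; _,_; proj₁; proj₂)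
open import Data.Product.Properties using (≡-dec)
open import Data.Sum using (_⊎_; inj₁; inj₂; [_,_]; swap)
open import Data.Unit using (tt)
open import Data.Vec using (_∷_; []; _[_]≔_; here; there)
open import Data.Vec.Properties using ([]≔-updates; []≔-minimal; []=⇒lookup; lookup∘tabulate)
open import Function.Base using (_∘_)
open import Function.Bundles using (_↔_; _⇔_; mk⇔; mk↔ₛ′; Equivalence)
open import Function.Construct.Identity using (↔-id)
open import Induction.WellFounded using (Acc; acc)
open import Relation.Binary.Definitions using (DecidableEquality; tri<; tri≈; tri>)
open import Relation.Binary.PropositionalEquality using (_≡_; _≢_; refl; trans; cong; subst; cong₂; subst₂) renaming (sym to ≡-sym)
open import Relation.Nullary using (¬_; Dec; yes; no; does)
open import Relation.Nullary.Decidable using (toSum; _×-dec_; ¬?; _⊎-dec_; map′; dec-false; does-⇔)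
open import Relation.Unary using (Decidable)
open import Data.List.Membership.DecPropositional _≟_ using () renaming (_∈?_ to _∈ℕ?_)

-- Outcome (ii) demands unique neighbours, while a vertex of `S` may have many neighbours in H. So
-- the vertices of `S` that steer the descent only locate branchings; they become part of the answer
-- only in outcome (i), which tolerates several neighbours. The vertices put at the ends of legs
-- come from minimality: such an `s` misses all of R, and the rest of the construction lies in R, so
-- `s` meets only its own leg.
--
-- No path is checked edge by edge for being induced. Edges of H change the depth by at most one, so
-- any sequence whose i-th vertex has depth i and whose consecutive vertices are adjacent is an
-- induced path. Rerouting replaces a vertex by one of the same depth, hence keeps this property.
--
-- The trunk may be arbitrarily long, so its length must not enter the bound. A step in which all
-- remaining vertices of `S` lie below one child discards nothing; only a step that records an event
-- shrinks the supply, by a factor of about `ramsey h h`. Ten times h events suffice: five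
-- behaviours, h of each, doubled because chosen depths must differ by at least two to make the
-- children there nonadjacent.

private
  variable
    A B : Set
    𝒫 𝒬 : A → Set
    ℛ : A → A → Set

-- Lists: Ramsey, pigeonhole and thinning.

least : {P : ℕ → Set} → Decidable P → ∀ k → P k → ∃[ m ] (m ≤ k × P m × (∀ j → j < m → ¬ P j))
least P? k pk with P? 0
... | yes p0 = 0 , z≤n , p0 , λ j ()
least P? zero pk | no ¬p0 = ⊥-elim (¬p0 pk)
least P? (suc k) pk | no ¬p0 with least (λ i → P? (suc i)) k pk
... | m , m≤k , pm , below = suc m , s≤s m≤k , pm , λ { zero _ → ¬p0 ; (suc j) (s≤s j<m) → below j j<m }

AllPairs-⊑ : ∀ {xs ys : List A} → ys ⊑ xs → AllPairs ℛ xs → AllPairs ℛ ys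
AllPairs-⊑ [] [] = []
AllPairs-⊑ (y ∷ʳ s) (_ ∷ r) = AllPairs-⊑ s r
AllPairs-⊑ (_∷_ refl s) (a ∷ r) = All-resp-⊆ s a ∷ AllPairs-⊑ s r

AllPairs-∈ : (∀ {x y} → ℛ x y → ℛ y x) → ∀ {xs : List A} → AllPairs ℛ xs →
  ∀ {x y} → x ∈ˡ xs → y ∈ˡ xs → x ≢ y → ℛ x y
AllPairs-∈ R-sym (r ∷ rs) (here refl) (here refl) x≢y = ⊥-elim (x≢y refl)
AllPairs-∈ R-sym (r ∷ rs) (here refl) (there y∈) x≢y = All.lookup r y∈
AllPairs-∈ R-sym (r ∷ rs) (there x∈) (here refl) x≢y = R-sym (All.lookup r x∈)
AllPairs-∈ R-sym (r ∷ rs) (there x∈) (there y∈) x≢y = AllPairs-∈ R-sym rs x∈ y∈ x≢y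

SublistOf : List A → (A → Set) → ℕ → Set
SublistOf {A = A} xs 𝒫 a = Σ (List A) λ ys → ys ⊑ xs × All 𝒫 ys × length ys ≡ a

split : ∀ a b (xs : List A) → All (λ x → 𝒫 x ⊎ 𝒬 x) xs → a + b ≤ length xs →
  SublistOf xs 𝒫 a ⊎ SublistOf xs 𝒬 b
split zero b xs pq le = inj₁ ([] , minimum xs , [] , refl)
split (suc a) zero xs pq le = inj₂ ([] , minimum xs , [] , refl)
split (suc a) (suc b) (x ∷ xs) (inj₁ p ∷ pq) (s≤s le) with split a (suc b) xs pq le
... | inj₁ (ys , s , ps , eq) = inj₁ (x ∷ ys , refl ∷ s , p ∷ ps , cong suc eq)
... | inj₂ (ys , s , qs , eq) = inj₂ (ys , x ∷ʳ s , qs , eq)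
split (suc a) (suc b) (x ∷ xs) (inj₂ q ∷ pq) (s≤s le)
  with split (suc a) b xs pq (≤-trans (≤-reflexive (≡-sym (+-suc a b))) le)
... | inj₁ (ys , s , ps , eq) = inj₁ (ys , x ∷ʳ s , ps , eq)
... | inj₂ (ys , s , qs , eq) = inj₂ (x ∷ ys , refl ∷ s , q ∷ qs , cong suc eq)

-- The Erdős-Szekeres recurrence, with an extra 1 for the head of the list, whose related and
-- unrelated elements `split` separates.
ramsey : ℕ → ℕ → ℕ
ramsey zero b = 0
ramsey (suc a) zero = 0
ramsey (suc a) (suc b) = suc (ramsey a (suc b) + ramsey (suc a) b)

ramsey-⊑ : (∀ x y → Dec (ℛ x y)) → ∀ a b (xs : List A) → ramsey a b ≤ length xs →
  (Σ (List A) λ ys → ys ⊑ xs × AllPairs ℛ ys × length ys ≡ a) ⊎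
  (Σ (List A) λ ys → ys ⊑ xs × AllPairs (λ x y → ¬ ℛ x y) ys × length ys ≡ b)
ramsey-⊑ ℛ? zero b xs le = inj₁ ([] , minimum xs , [] , refl)
ramsey-⊑ ℛ? (suc a) zero xs le = inj₂ ([] , minimum xs , [] , refl)
ramsey-⊑ {ℛ = ℛ} ℛ? (suc a) (suc b) (x ∷ xs) (s≤s le)
  with split {𝒫 = ℛ x} (ramsey a (suc b)) (ramsey (suc a) b) xs
         (All.universal (λ y → toSum (ℛ? x y)) xs) le
... | inj₁ (ys , s , ps , eq) with ramsey-⊑ ℛ? a (suc b) ys (≤-reflexive (≡-sym eq))
...   | inj₁ (zs , t , cl , eq′) = inj₁ (x ∷ zs , refl ∷ ⊆-trans t s , All-resp-⊆ t ps ∷ cl , cong suc eq′)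
...   | inj₂ (zs , t , st , eq′) = inj₂ (zs , x ∷ʳ ⊆-trans t s , st , eq′)
ramsey-⊑ ℛ? (suc a) (suc b) (x ∷ xs) (s≤s le) | inj₂ (ys , s , ps , eq)
  with ramsey-⊑ ℛ? (suc a) b ys (≤-reflexive (≡-sym eq))
...   | inj₁ (zs , t , cl , eq′) = inj₁ (zs , x ∷ʳ ⊆-trans t s , cl , eq′)
...   | inj₂ (zs , t , st , eq′) = inj₂ (x ∷ zs , refl ∷ ⊆-trans t s , All-resp-⊆ t ps ∷ st , cong suc eq′)

-- Greedy: either `N` further elements share the key of the head, or `M * suc N` elements with other
-- keys remain and the head joins the representatives found among them.
pigeonhole : DecidableEquality B → (key : A → B) → ∀ M N (xs : List A) → M * suc N ≤ length xs →
  (Σ (List A) λ ys → All (_∈ˡ xs) ys × AllPairs (λ x y → key x ≢ key y) ys × length ys ≡ M) ⊎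
  (Σ A λ x → x ∈ˡ xs × Σ (List A) λ ys → ys ⊑ xs × All (λ y → key y ≡ key x) ys × length ys ≡ suc N)
pigeonhole _≟_ key zero N xs le = inj₁ ([] , [] , [] , refl)
pigeonhole _≟_ key (suc M) N (x ∷ xs) (s≤s le)
  with split {𝒫 = λ y → key y ≡ key x} N (M * suc N) xs
         (All.universal (λ y → toSum (key y ≟ key x)) xs) le
... | inj₁ (ys , s , ps , eq) = inj₂ (x , here refl , x ∷ ys , refl ∷ s , refl ∷ ps , cong suc eq)
... | inj₂ (ys , s , ps , eq) with pigeonhole _≟_ key M N ys (≤-reflexive (≡-sym eq))
...   | inj₁ (zs , m , d , eq′) = inj₁ (x ∷ zs
          , here refl ∷ All.map (λ z∈ → there (⊑-∈ s z∈)) m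
          , All.map (λ z∈ e → All.lookup ps z∈ (≡-sym e)) m ∷ d
          , cong suc eq′)
...   | inj₂ (w , w∈ , zs , t , c , eq′) = inj₂ (w , there (⊑-∈ s w∈) , zs , x ∷ʳ ⊆-trans t s , c , eq′)

-- Dropping every second index serves twice: kept indices are at least two apart, and above each
-- kept index there is a dropped one, which keeps it away from the end of the trunk. An unpaired
-- last element is dropped for the second purpose.
alternate : List A → List A
alternate [] = []
alternate (x ∷ []) = []
alternate (x ∷ y ∷ xs) = x ∷ alternate xs

length-alternate : ∀ k (xs : List A) → length xs ≡ k + k → length (alternate xs) ≡ k
length-alternate zero [] eq = refl
length-alternate (suc k) (x ∷ []) eq with trans eq (cong suc (+-suc k k))
... | ()
length-alternate (suc k) (x ∷ y ∷ xs) eq =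
  cong suc (length-alternate k xs (suc-injective (suc-injective (trans eq (cong suc (+-suc k k))))))

alternate-⊑ : (xs : List A) → alternate xs ⊑ xs
alternate-⊑ [] = []
alternate-⊑ (x ∷ []) = x ∷ʳ []
alternate-⊑ (x ∷ y ∷ xs) = refl ∷ (y ∷ʳ alternate-⊑ xs)

alternate-gaps : ∀ {xs : List ℕ} → AllPairs _<_ xs → AllPairs (λ i j → suc i < j) (alternate xs)
alternate-gaps [] = []
alternate-gaps (_ ∷ []) = []
alternate-gaps {xs = x ∷ y ∷ xs} ((x<y ∷ _) ∷ y< ∷ r) =
  All.map (λ y<z → ≤-trans (s≤s x<y) y<z) (All-resp-⊆ (alternate-⊑ xs) y<) ∷ alternate-gaps r

alternate-room : ∀ {m} {xs : List ℕ} → AllPairs _<_ xs → All (_< m) xs → All (λ i → suc i < m) (alternate xs)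
alternate-room [] [] = []
alternate-room (_ ∷ []) _ = []
alternate-room ((x<y ∷ _) ∷ _ ∷ r) (_ ∷ y<m ∷ b) = ≤-trans (s≤s x<y) y<m ∷ alternate-room r b

-- Finite subsets and duplicate-free lists.

private
  variable
    card : ℕ

∈-[]≔⁻ : ∀ (p : Subset card) x {y} → y ∈ p [ x ]≔ inside → y ≡ x ⊎ y ∈ p
∈-[]≔⁻ (_ ∷ p) zero here = inj₁ refl
∈-[]≔⁻ (_ ∷ p) zero (there y∈) = inj₂ (there y∈)
∈-[]≔⁻ (_ ∷ p) (suc x) here = inj₂ here
∈-[]≔⁻ (_ ∷ p) (suc x) (there y∈) with ∈-[]≔⁻ p x y∈
... | inj₁ refl = inj₁ refl
... | inj₂ y∈p = inj₂ (there y∈p)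

∈-[]≔⁺ : ∀ (p : Subset card) x {y} → y ∈ p → y ∈ p [ x ]≔ inside
∈-[]≔⁺ p x {y} y∈ with x Fin.≟ y
... | yes refl = []≔-updates p x
... | no x≢y = []≔-minimal p y x (λ y≡x → x≢y (≡-sym y≡x)) y∈

∣[]≔∣ : ∀ (p : Subset card) x → x ∉ p → ∣ p [ x ]≔ inside ∣ ≡ suc ∣ p ∣
∣[]≔∣ (outside ∷ p) zero x∉ = refl
∣[]≔∣ (inside ∷ p) zero x∉ = ⊥-elim (x∉ here)
∣[]≔∣ (outside ∷ p) (suc x) x∉ = ∣[]≔∣ p x (λ x∈ → x∉ (there x∈))
∣[]≔∣ (inside ∷ p) (suc x) x∉ = cong suc (∣[]≔∣ p x (λ x∈ → x∉ (there x∈)))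

setOf : List (Fin card) → Subset card
setOf [] = ⊥
setOf (x ∷ xs) = setOf xs [ x ]≔ inside

∈-setOf⁺ : ∀ {xs : List (Fin card)} {x} → x ∈ˡ xs → x ∈ setOf xs
∈-setOf⁺ {xs = x ∷ xs} (here refl) = []≔-updates (setOf xs) x
∈-setOf⁺ {xs = y ∷ xs} (there x∈) = ∈-[]≔⁺ (setOf xs) y (∈-setOf⁺ x∈)

∈-setOf⁻ : ∀ (xs : List (Fin card)) {x} → x ∈ setOf xs → x ∈ˡ xs
∈-setOf⁻ [] x∈ = ⊥-elim (∉⊥ x∈)
∈-setOf⁻ (y ∷ xs) x∈ with ∈-[]≔⁻ (setOf xs) y x∈
... | inj₁ refl = here refl
... | inj₂ x∈′ = there (∈-setOf⁻ xs x∈′)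

∣setOf∣ : ∀ {xs : List (Fin card)} → Unique xs → ∣ setOf xs ∣ ≡ length xs
∣setOf∣ {card} [] = ∣⊥∣≡0 card
∣setOf∣ {xs = x ∷ xs} (x≢ ∷ u) =
  trans (∣[]≔∣ (setOf xs) x (λ x∈ → All.lookup x≢ (∈-setOf⁻ xs x∈) refl)) (cong suc (∣setOf∣ u))

∣p∣≤1+∣p-x∣ : ∀ (p : Subset card) x → ∣ p ∣ ≤ suc ∣ p - x ∣
∣p∣≤1+∣p-x∣ (inside ∷ p) zero = s≤s (≤-reflexive (cong ∣_∣ (≡-sym (p─⊥≡p p))))
∣p∣≤1+∣p-x∣ (outside ∷ p) zero = m≤n⇒m≤1+n (≤-reflexive (cong ∣_∣ (≡-sym (p─⊥≡p p))))
∣p∣≤1+∣p-x∣ (inside ∷ p) (suc x) = s≤s (∣p∣≤1+∣p-x∣ p x)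
∣p∣≤1+∣p-x∣ (outside ∷ p) (suc x) = ∣p∣≤1+∣p-x∣ p x

x∈p-y⇒x∈p : ∀ (p : Subset card) y {x} → x ∈ p - y → x ∈ p
x∈p-y⇒x∈p (_ ∷ p) zero {suc x} (there x∈) = there (subst (x ∈_) (p─⊥≡p p) x∈)
x∈p-y⇒x∈p (inside ∷ p) (suc y) here = here
x∈p-y⇒x∈p (_ ∷ p) (suc y) (there x∈) = there (x∈p-y⇒x∈p p y x∈)

x∉p-x : ∀ (p : Subset card) x → x ∉ p - x
x∉p-x (inside ∷ p) zero ()
x∉p-x (outside ∷ p) zero ()
x∉p-x (_ ∷ p) (suc x) (there x∈) = x∉p-x p x x∈

-- Counting through an injection `f` lets a degree be bounded by a list of coordinates instead of a
-- list of vertices.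
∣p∣≤length : DecidableEquality B → (f : Fin card → B) → (∀ x y → f x ≡ f y → x ≡ y) →
  ∀ (L : List B) (p : Subset card) → (∀ x → x ∈ p → f x ∈ˡ L) → ∣ p ∣ ≤ length L
∣p∣≤length {card = card} _≟_ f inj [] p sub =
  ≤-reflexive (trans (cong ∣_∣ (Empty-unique λ { (x , x∈) → no-member (sub x x∈) })) (∣⊥∣≡0 card))
  where
  no-member : ∀ {b} → ¬ (b ∈ˡ [])
  no-member ()
∣p∣≤length _≟_ f inj (b ∷ L) p sub with Fin.any? (λ x → (x ∈? p) ×-dec (f x ≟ b))
... | yes (x , x∈ , refl) = ≤-trans (∣p∣≤1+∣p-x∣ p x)
        (s≤s (∣p∣≤length _≟_ f inj L (p - x) λ y y∈ → rest y y∈ (sub y (x∈p-y⇒x∈p p x y∈))))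
  where
  rest : ∀ y → y ∈ p - x → f y ∈ˡ f x ∷ L → f y ∈ˡ L
  rest y y∈ (here eq) with inj y x eq
  ... | refl = ⊥-elim (x∉p-x p x y∈)
  rest y y∈ (there fy∈) = fy∈
... | no none = m≤n⇒m≤1+n (∣p∣≤length _≟_ f inj L p λ y y∈ → rest y y∈ (sub y y∈))
  where
  rest : ∀ y → y ∈ p → f y ∈ˡ b ∷ L → f y ∈ˡ L
  rest y y∈ (here eq) = ⊥-elim (none (y , y∈ , eq))
  rest y y∈ (there fy∈) = fy∈

elements : Subset card → List (Fin card)
elements p = filter (_∈? p) (allFin _)

elements-unique : (p : Subset card) → Unique (elements p)
elements-unique p = Unique.filter⁺ (_∈? p) (Unique.allFin⁺ _)

∈-elements⁻ : ∀ (p : Subset card) {x} → x ∈ˡ elements p → x ∈ p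
∈-elements⁻ p x∈ = proj₂ (∈-filter⁻ (_∈? p) {xs = allFin _} x∈)

∣p∣≤length-elements : (p : Subset card) → ∣ p ∣ ≤ length (elements p)
∣p∣≤length-elements p = ∣p∣≤length Fin._≟_ (λ x → x) (λ _ _ eq → eq) (elements p) p
  λ x x∈ → ∈-filter⁺ (_∈? p) (∈-allFin x) x∈

-- Reachability, components and breadth-first layers.

module Layers (G : Graph) where

  V : Set
  V = Fin (n G)

  _~_ : V → V → Set
  u ~ v = Adjacent G u v

  _~?_ : ∀ u v → Dec (u ~ v)
  u ~? v = adj G u v Bool.≟ true

  ~-sym : ∀ {u v} → u ~ v → v ~ u
  ~-sym {u} {v} e = trans (Graph.sym G v u) e

  ~-irrefl : ∀ {u v} → u ~ v → u ≢ v
  ~-irrefl {u} e refl with trans (≡-sym e) (irrefl G u)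
  ... | ()

  -- The length is an index so that every instance is decidable and the distance can be found by
  -- `least`.
  data Reach (X : Subset (n G)) (r : V) : ℕ → V → Set where
    start : r ∈ X → Reach X r 0 r
    snoc  : ∀ {k u v} → Reach X r k u → u ~ v → v ∈ X → Reach X r (suc k) v

  Spans : Subset (n G) → V → Set
  Spans X r = ∀ v → v ∈ X → ∃[ k ] Reach X r k v

  Reach-∈ : ∀ {X r k v} → Reach X r k v → v ∈ X
  Reach-∈ (start r∈) = r∈
  Reach-∈ (snoc _ _ v∈) = v∈

  Reach-mono : ∀ {X Y r k v} → X ⊆ Y → Reach X r k v → Reach Y r k v
  Reach-mono X⊆Y (start r∈) = start (X⊆Y r∈)
  Reach-mono X⊆Y (snoc ρ e v∈) = snoc (Reach-mono X⊆Y ρ) e (X⊆Y v∈)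

  Reach-closed : ∀ {X Y r} → r ∈ Y → (∀ {u v} → u ∈ Y → u ~ v → v ∈ X → v ∈ Y) → ∀ {k v} → Reach X r k v → v ∈ Y
  Reach-closed r∈ closed (start _) = r∈
  Reach-closed r∈ closed (snoc ρ e v∈) = closed (Reach-closed r∈ closed ρ) e v∈

  Walk⇒Reach : ∀ {X r k u v} → Reach X r k u → Walk G X u v → ∃[ k ] Reach X r k v
  Walk⇒Reach ρ (here _) = _ , ρ
  Walk⇒Reach ρ (step _ e w) = Walk⇒Reach (snoc ρ e (Walk-∈ w)) w
    where
    Walk-∈ : ∀ {X u v} → Walk G X u v → u ∈ X
    Walk-∈ (here u∈) = u∈
    Walk-∈ (step u∈ _ _) = u∈

  Reach? : ∀ X r k v → Dec (Reach X r k v)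
  Reach? X r zero v with r Fin.≟ v
  ... | no r≢v = no λ { (start _) → r≢v refl }
  ... | yes refl with r ∈? X
  ...   | yes r∈ = yes (start r∈)
  ...   | no r∉ = no λ { (start r∈) → r∉ r∈ }
  Reach? X r (suc k) v with v ∈? X
  ... | no v∉ = no λ { (snoc _ _ v∈) → v∉ v∈ }
  ... | yes v∈ with Fin.any? (λ u → Reach? X r k u ×-dec (u ~? v))
  ...   | yes (u , ρ , e) = yes (snoc ρ e v∈)
  ...   | no none = no λ { (snoc ρ e _) → none (_ , ρ , e) }

  record Component (X : Subset (n G)) (r : V) : Set where
    field
      set    : Subset (n G)
      root   : r ∈ set
      within : set ⊆ X
      spans  : Spans set r
      closed : ∀ {u v} → u ∈ set → u ~ v → v ∈ X → v ∈ set

  component : ∀ X r → r ∈ X → Component X r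
  component X r r∈ = grow ⁅ r ⁆ (<-wellFounded _) (x∈⁅x⁆ r)
      (λ v∈ → subst (_∈ X) (≡-sym (x∈⁅y⁆⇒x≡y r v∈)) r∈)
      (λ v v∈ → 0 , subst (Reach ⁅ r ⁆ r 0) (≡-sym (x∈⁅y⁆⇒x≡y r v∈)) (start (x∈⁅x⁆ r)))
    where
    grow : ∀ C → Acc _<_ (n G ∸ ∣ C ∣) → r ∈ C → C ⊆ X → Spans C r → Component X r
    grow C (acc rec) r∈C C⊆X sp
      with Fin.any? (λ u → (u ∈? C) ×-dec Fin.any? (λ v → (u ~? v) ×-dec ((v ∈? X) ×-dec ¬? (v ∈? C))))
    ... | no none = record
      { set = C ; root = r∈C ; within = C⊆X ; spans = sp ; closed = closed }
      where
      closed : ∀ {u v} → u ∈ C → u ~ v → v ∈ X → v ∈ C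
      closed {u} {v} u∈ e v∈ with v ∈? C
      ... | yes v∈C = v∈C
      ... | no v∉C = ⊥-elim (none (u , u∈ , v , e , v∈ , v∉C))
    ... | yes (u , u∈ , v , e , v∈ , v∉) = grow C⁺ (rec smaller) (C⊆C⁺ r∈C) C⁺⊆X sp⁺
      where
      C⁺ = C [ v ]≔ inside
      C⊆C⁺ : C ⊆ C⁺
      C⊆C⁺ = ∈-[]≔⁺ C v
      C⁺⊆X : C⁺ ⊆ X
      C⁺⊆X x∈ with ∈-[]≔⁻ C v x∈
      ... | inj₁ refl = v∈
      ... | inj₂ x∈C = C⊆X x∈C
      sp⁺ : Spans C⁺ r
      sp⁺ x x∈ with ∈-[]≔⁻ C v x∈
      ... | inj₁ refl = _ , snoc (Reach-mono C⊆C⁺ (proj₂ (sp u u∈))) e ([]≔-updates C v)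
      ... | inj₂ x∈C = _ , Reach-mono C⊆C⁺ (proj₂ (sp x x∈C))
      smaller : n G ∸ ∣ C⁺ ∣ < n G ∸ ∣ C ∣
      smaller = ∸-monoʳ-< (≤-reflexive (≡-sym (∣[]≔∣ C v v∉))) (∣p∣≤n C⁺)

  -- The breadth-first layering of G[X] from r; depth and parent are junk (0 and the vertex itself) outside X.
  module Layering (X : Subset (n G)) (r : V) (r∈ : r ∈ X) (sp : Spans X r) where

    -- Depth and parent are indices of one relation, so that a single case split on `layer v`
    -- evaluates both.
    data Layer (v : V) : ℕ → V → Set where
      top   : v ≡ r → Layer v 0 v
      below : ∀ {k u} → Reach X r k u → u ~ v → v ∈ X → (∀ j → j < suc k → ¬ Reach X r j v) → Layer v (suc k) u
      junk  : v ∉ X → Layer v 0 v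

    layer : ∀ v → ∃[ k ] ∃[ u ] Layer v k u
    layer v with v ∈? X
    ... | no v∉ = 0 , v , junk v∉
    ... | yes v∈ with least (λ k → Reach? X r k v) (proj₁ (sp v v∈)) (proj₂ (sp v v∈))
    ...   | zero , _ , start _ , _ = 0 , v , top refl
    ...   | suc k , _ , snoc ρ e _ , lo = suc k , _ , below ρ e v∈ lo

    depth : V → ℕ
    depth v = proj₁ (layer v)

    parent : V → V
    parent v = proj₁ (proj₂ (layer v))

    depth-Reach : ∀ {v} → v ∈ X → Reach X r (depth v) v
    depth-Reach {v} v∈ with layer v
    ... | _ , _ , top refl = start r∈
    ... | _ , _ , below ρ e _ _ = snoc ρ e v∈
    ... | _ , _ , junk v∉ = ⊥-elim (v∉ v∈)

    depth-least : ∀ {v k} → Reach X r k v → depth v ≤ k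
    depth-least {v} {k} ρ with layer v
    ... | _ , _ , top _ = z≤n
    ... | _ , _ , junk _ = z≤n
    ... | _ , _ , below _ _ _ lo = ≮⇒≥ (λ k< → lo k k< ρ)

    depth-root : depth r ≡ 0
    depth-root = n≤0⇒n≡0 (depth-least (start r∈))

    depth-zero : ∀ {v} → v ∈ X → depth v ≡ 0 → v ≡ r
    depth-zero {v} v∈ d≡0 with subst (λ k → Reach X r k v) d≡0 (depth-Reach v∈)
    ... | start _ = refl

    depth-Lipschitz : ∀ {u v} → u ∈ X → v ∈ X → u ~ v → depth v ≤ suc (depth u)
    depth-Lipschitz u∈ v∈ e = depth-least (snoc (depth-Reach u∈) e v∈)

    parent-props : ∀ {v k} → v ∈ X → depth v ≡ suc k → parent v ∈ X × parent v ~ v × depth (parent v) ≡ k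
    parent-props {v} {k} v∈ eq with layer v
    parent-props {v} {k} v∈ refl | _ , u , below ρ e _ lo =
      Reach-∈ ρ , e , ≤-antisym (depth-least ρ)
        (≮⇒≥ λ d< → lo (suc (depth u)) (s≤s d<) (snoc (depth-Reach (Reach-∈ ρ)) e v∈))

    up : ℕ → V → V
    up zero v = v
    up (suc k) v = parent (up k v)

    up-props : ∀ k {v} → v ∈ X → k ≤ depth v → up k v ∈ X × depth (up k v) ≡ depth v ∸ k
    up-props zero v∈ _ = v∈ , refl
    up-props (suc k) {v} v∈ k< with up-props k v∈ (<⇒≤ k<)
    ... | u∈ , eq with parent-props u∈ (trans eq (trans (∸-suc (depth v) k k<) refl))
      where
      ∸-suc : ∀ d k → suc k ≤ d → d ∸ k ≡ suc (d ∸ suc k)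
      ∸-suc (suc d) zero _ = refl
      ∸-suc (suc d) (suc k) (s≤s le) = ∸-suc d k le
    ...   | p∈ , _ , eq′ = p∈ , eq′

    -- The ancestor of v at depth i, and v itself for i beyond the depth of v.
    ancestor : V → ℕ → V
    ancestor v i = up (depth v ∸ i) v

    ancestor-self : ∀ {v i} → depth v ≤ i → ancestor v i ≡ v
    ancestor-self {v} {i} le rewrite m≤n⇒m∸n≡0 le = refl

    ancestor-∈ : ∀ {v} → v ∈ X → ∀ i → ancestor v i ∈ X
    ancestor-∈ {v} v∈ i = proj₁ (up-props (depth v ∸ i) v∈ (m∸n≤m (depth v) i))

    ancestor-depth : ∀ {v} → v ∈ X → ∀ {i} → i ≤ depth v → depth (ancestor v i) ≡ i
    ancestor-depth {v} v∈ {i} le =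
      trans (proj₂ (up-props (depth v ∸ i) v∈ (m∸n≤m (depth v) i))) (m∸[m∸n]≡n le)

    ancestor-parent : ∀ {v i} → i < depth v → parent (ancestor v (suc i)) ≡ ancestor v i
    ancestor-parent {v} {i} lt = cong (λ k → up k v) (≡-sym (+-∸-assoc 1 lt))

    ancestor-step : ∀ {v} → v ∈ X → ∀ {i} → i < depth v → ancestor v i ~ ancestor v (suc i)
    ancestor-step {v} v∈ {i} lt =
      subst (_~ ancestor v (suc i)) (ancestor-parent lt)
        (proj₁ (proj₂ (parent-props (ancestor-∈ v∈ (suc i)) (ancestor-depth v∈ lt))))

    -- These three fields already force an induced path: depth separates the vertices, and
    -- `depth-Lipschitz` forbids every edge that skips a layer.
    record Layered (q : ℕ → V) (m : ℕ) : Set where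
      field
        in-X   : ∀ {i} → i ≤ m → q i ∈ X
        at     : ∀ {i} → i ≤ m → depth (q i) ≡ i
        next   : ∀ {i} → i < m → q i ~ q (suc i)

      adj⇒≤ : ∀ {i j} → i ≤ m → j ≤ m → q i ~ q j → j ≤ suc i
      adj⇒≤ i≤ j≤ e = ≤-trans (≤-reflexive (≡-sym (at j≤)))
        (≤-trans (depth-Lipschitz (in-X i≤) (in-X j≤) e) (s≤s (≤-reflexive (at i≤))))

      adj⇒consecutive : ∀ {i j} → i ≤ m → j ≤ m → q i ~ q j → suc i ≡ j ⊎ suc j ≡ i
      adj⇒consecutive {i} {j} i≤ j≤ e with <-cmp i j
      ... | tri< i<j _ _ = inj₁ (≤-antisym i<j (adj⇒≤ i≤ j≤ e))
      ... | tri≈ _ refl _ = ⊥-elim (~-irrefl e refl)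
      ... | tri> _ _ j<i = inj₂ (≤-antisym j<i (adj⇒≤ j≤ i≤ (~-sym e)))

      consecutive⇒adj : ∀ {i j} → i ≤ m → j ≤ m → suc i ≡ j ⊎ suc j ≡ i → q i ~ q j
      consecutive⇒adj i≤ j≤ (inj₁ refl) = next j≤
      consecutive⇒adj i≤ j≤ (inj₂ refl) = ~-sym (next i≤)

      inj : ∀ {i j} → i ≤ m → j ≤ m → q i ≡ q j → i ≡ j
      inj i≤ j≤ eq = trans (≡-sym (at i≤)) (trans (cong depth eq) (at j≤))

    ancestor-layered : ∀ {v} → v ∈ X → Layered (ancestor v) (depth v)
    ancestor-layered v∈ = record
      { in-X = λ {i} _ → ancestor-∈ v∈ i ; at = ancestor-depth v∈ ; next = ancestor-step v∈ }

    Layered-≤ : ∀ {q m m′} → m′ ≤ m → Layered q m → Layered q m′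
    Layered-≤ le L = record
      { in-X = λ i≤ → Layered.in-X L (≤-trans i≤ le) ; at = λ i≤ → Layered.at L (≤-trans i≤ le)
      ; next = λ i< → Layered.next L (≤-trans i< le) }

    -- Cutting the root path of `w` at its first vertex with `Q` makes the last vertex the only one
    -- with `Q`. With `Q` the adjacency to `s`, this gives `s` a unique neighbour on its pendant.
    first-hit : {Q : V → Set} → Decidable Q → ∀ {w} → w ∈ X → Q w →
      Σ (ℕ → V) λ x → ∃[ t ] (x 0 ≡ r × Layered x t × Q (x t) × (∀ j → j < t → ¬ Q (x j)))
    first-hit {Q} Q? {w} w∈ qw
      with least (λ i → Q? (ancestor w i)) (depth w) (subst Q (≡-sym (ancestor-self ≤-refl)) qw)
    ... | t , t≤ , qt , before = ancestor w , t , depth-zero (ancestor-∈ w∈ 0) (ancestor-depth w∈ z≤n)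
          , Layered-≤ t≤ (ancestor-layered w∈) , qt , before

-- Coordinates for combs, line graphs of combs and subdivided stars.

-- Lexicographic enumeration of the cells (i , j) with i < m and j ≤ ℓ i.

total : ℕ → (ℕ → ℕ) → ℕ
total zero ℓ = 0
total (suc m) ℓ = suc (ℓ 0) + total m (ℓ ∘ suc)

FinCell : ℕ → (ℕ → ℕ) → Set
FinCell m ℓ = Σ (Fin m) λ i → Fin (suc (ℓ (toℕ i)))

position : ∀ m ℓ → FinCell m ℓ → Fin (total m ℓ)
position (suc m) ℓ (zero , j) = j ↑ˡ _
position (suc m) ℓ (suc i , j) = suc (ℓ 0) ↑ʳ position m (ℓ ∘ suc) (i , j)

next-row : ∀ m ℓ → FinCell m (ℓ ∘ suc) → FinCell (suc m) ℓ
next-row m ℓ (i , j) = suc i , j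

finCell : ∀ m ℓ → Fin (total m ℓ) → FinCell m ℓ
finCell (suc m) ℓ u = [ (λ j → zero , j) , (λ v → next-row m ℓ (finCell m (ℓ ∘ suc) v)) ] (splitAt (suc (ℓ 0)) u)

finCell-position : ∀ m ℓ c → finCell m ℓ (position m ℓ c) ≡ c
finCell-position (suc m) ℓ (zero , j) rewrite Fin.splitAt-↑ˡ (suc (ℓ 0)) j (total m (ℓ ∘ suc)) = refl
finCell-position (suc m) ℓ (suc i , j)
  rewrite Fin.splitAt-↑ʳ (suc (ℓ 0)) (total m (ℓ ∘ suc)) (position m (ℓ ∘ suc) (i , j)) =
  cong (next-row m ℓ) (finCell-position m (ℓ ∘ suc) (i , j))

position-finCell : ∀ m ℓ u → position m ℓ (finCell m ℓ u) ≡ u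
position-finCell (suc m) ℓ u with splitAt (suc (ℓ 0)) u in eq
... | inj₁ j = Fin.splitAt⁻¹-↑ˡ eq
... | inj₂ v = trans (cong (suc (ℓ 0) ↑ʳ_) (position-finCell m (ℓ ∘ suc) v)) (Fin.splitAt⁻¹-↑ʳ eq)

coords : ∀ m ℓ → FinCell m ℓ → ℕ × ℕ
coords m ℓ (i , j) = toℕ i , toℕ j

coords-injective : ∀ m ℓ (c c′ : FinCell m ℓ) → coords m ℓ c ≡ coords m ℓ c′ → c ≡ c′
coords-injective m ℓ (i , j) (i′ , j′) eq with Fin.toℕ-injective {i = i} {j = i′} (cong proj₁ eq)
... | refl = cong (i ,_) (Fin.toℕ-injective (cong proj₂ eq))

Cell : ℕ → (ℕ → ℕ) → ℕ × ℕ → Set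
Cell m ℓ (i , j) = i < m × j ≤ ℓ i

toFin : ∀ {m i} → i < m → ∃[ i′ ] (toℕ {m} i′ ≡ i)
toFin i<m = fromℕ< i<m , Fin.toℕ-fromℕ< i<m

cell : ∀ m ℓ → Fin (total m ℓ) → ℕ × ℕ
cell m ℓ u = coords m ℓ (finCell m ℓ u)

cell-Cell : ∀ m ℓ u → Cell m ℓ (cell m ℓ u)
cell-Cell m ℓ u with finCell m ℓ u
... | i , j = Fin.toℕ<n i , ≤-pred (Fin.toℕ<n j)

cell-injective : ∀ m ℓ u v → cell m ℓ u ≡ cell m ℓ v → u ≡ v
cell-injective m ℓ u v eq = trans (≡-sym (position-finCell m ℓ u))
  (trans (cong (position m ℓ) (coords-injective m ℓ (finCell m ℓ u) (finCell m ℓ v) eq)) (position-finCell m ℓ v))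

cell-at : ∀ m ℓ w → Cell m ℓ w → ∃[ u ] cell m ℓ u ≡ w
cell-at m ℓ (i , j) (i<m , j≤) with toFin i<m
... | i′ , refl with toFin (s≤s j≤)
...   | j′ , refl = position m ℓ (i′ , j′) , cong (coords m ℓ) (finCell-position m ℓ (i′ , j′))

-- Combs: the spine is the column j = 0, and row i is a leg with ℓ i further vertices.

data Parent : ℕ × ℕ → ℕ × ℕ → Set where
  leg   : ∀ {i j} → Parent (i , j) (i , suc j)
  spine : ∀ {i} → Parent (i , 0) (suc i , 0)

data Siblings : ℕ × ℕ → ℕ × ℕ → Set where
  siblings : ∀ {i} → Siblings (i , 1) (suc i , 0)

CombAdj : ℕ × ℕ → ℕ × ℕ → Set
CombAdj w w′ = Parent w w′ ⊎ Parent w′ w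

-- A non-root cell stands for the edge to its parent.
LineAdj : ℕ × ℕ → ℕ × ℕ → Set
LineAdj w w′ = CombAdj w w′ ⊎ (Siblings w w′ ⊎ Siblings w′ w)

_≟²_ : DecidableEquality (ℕ × ℕ)
_≟²_ = ≡-dec _≟_ _≟_

Parent? : ∀ w w′ → Dec (Parent w w′)
Parent? w (zero , zero) = no λ ()
Parent? w (suc i , zero) = map′ (λ { refl → spine }) (λ { spine → refl }) (w ≟² (i , 0))
Parent? w (i , suc j) = map′ (λ { refl → leg }) (λ { leg → refl }) (w ≟² (i , j))

CombAdj? : ∀ w w′ → Dec (CombAdj w w′)
CombAdj? w w′ = Parent? w w′ ⊎-dec Parent? w′ w

Parent-unique : ∀ {a b w} → Parent a w → Parent b w → a ≡ b
Parent-unique leg leg = refl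
Parent-unique spine spine = refl

height : ℕ × ℕ → ℕ
height (i , j) = i + j

Parent-height : ∀ {a w} → Parent a w → suc (height a) ≡ height w
Parent-height {w = i , suc j} leg = ≡-sym (+-suc i j)
Parent-height spine = refl

position-mono-leg : ∀ m ℓ i j j′ → toℕ j < toℕ j′ → toℕ (position m ℓ (i , j)) < toℕ (position m ℓ (i , j′))
position-mono-leg (suc m) ℓ zero j j′ lt = subst₂ _<_ (≡-sym (Fin.toℕ-↑ˡ j _)) (≡-sym (Fin.toℕ-↑ˡ j′ _)) lt
position-mono-leg (suc m) ℓ (suc i) j j′ lt =
  subst₂ _<_ (≡-sym (Fin.toℕ-↑ʳ (suc (ℓ 0)) _)) (≡-sym (Fin.toℕ-↑ʳ (suc (ℓ 0)) _))
    (+-monoʳ-< (suc (ℓ 0)) (position-mono-leg m (ℓ ∘ suc) i j j′ lt))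

position-mono-row : ∀ m ℓ i i′ j j′ → toℕ i < toℕ i′ → toℕ (position m ℓ (i , j)) < toℕ (position m ℓ (i′ , j′))
position-mono-row (suc m) ℓ zero (suc i′) j j′ lt =
  subst₂ _<_ (≡-sym (Fin.toℕ-↑ˡ j _)) (≡-sym (Fin.toℕ-↑ʳ (suc (ℓ 0)) _))
    (≤-trans (Fin.toℕ<n j) (m≤m+n (suc (ℓ 0)) _))
position-mono-row (suc m) ℓ (suc i) (suc i′) j j′ (s≤s lt) =
  subst₂ _<_ (≡-sym (Fin.toℕ-↑ʳ (suc (ℓ 0)) _)) (≡-sym (Fin.toℕ-↑ʳ (suc (ℓ 0)) _))
    (+-monoʳ-< (suc (ℓ 0)) (position-mono-row m (ℓ ∘ suc) i i′ j j′ lt))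

-- `IsLineGraphOf` lists every edge with its smaller end first; in the lexicographic order this is
-- always the parent.
Parent⇒< : ∀ m ℓ u v → Parent (cell m ℓ u) (cell m ℓ v) → toℕ u < toℕ v
Parent⇒< m ℓ u v p = subst₂ (λ u v → toℕ u < toℕ v) (position-finCell m ℓ u) (position-finCell m ℓ v)
    (go (finCell m ℓ u) (finCell m ℓ v) refl refl p)
  where
  go : ∀ {w w′} (c c′ : FinCell m ℓ) → coords m ℓ c ≡ w → coords m ℓ c′ ≡ w′ → Parent w w′ →
    toℕ (position m ℓ c) < toℕ (position m ℓ c′)
  go (i , j) (i′ , j′) eq eq′ leg with Fin.toℕ-injective {i = i} {j = i′} (trans (cong proj₁ eq) (≡-sym (cong proj₁ eq′)))
  ... | refl = position-mono-leg m ℓ i j j′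
          (≤-reflexive (trans (cong (suc ∘ proj₂) eq) (≡-sym (cong proj₂ eq′))))
  go (i , j) (i′ , j′) eq eq′ spine = position-mono-row m ℓ i i′ j j′
    (≤-reflexive (trans (cong (suc ∘ proj₁) eq) (≡-sym (cong proj₁ eq′))))

Parent-Cell : ∀ {m ℓ a w} → Parent a w → Cell m ℓ w → Cell m ℓ a
Parent-Cell leg (i< , j≤) = i< , <⇒≤ j≤
Parent-Cell spine (i< , _) = <⇒≤ i< , z≤n

argmax : ∀ {k} (f : Fin (suc k) → ℕ) → ∃[ i ] (∀ j → f j ≤ f i)
argmax {zero} f = zero , λ { zero → ≤-refl }
argmax {suc k} f with argmax (f ∘ suc)
... | i , max with f zero ≤? f (suc i)
...   | yes le = suc i , λ { zero → le ; (suc j) → max j }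
...   | no ≰ = zero , λ { zero → ≤-refl ; (suc j) → ≤-trans (max j) (<⇒≤ (≰⇒> ≰)) }

-- The top of a cycle would have two distinct lower neighbours.
acyclic : ∀ (H : Graph) (rank : Fin (n H) → ℕ) → (∀ u v → Adjacent H u v → rank u ≢ rank v) →
  (∀ u v w → Adjacent H u v → Adjacent H u w → rank v < rank u → rank w < rank u → v ≡ w) → ¬ HasCycle H
acyclic H rank differ unique (k , c , inj , next , close) with argmax (rank ∘ c)
... | i , max with around i
  where
  H-sym : ∀ {u v} → Adjacent H u v → Adjacent H v u
  H-sym {u} {v} e = trans (Graph.sym H v u) e
  around : ∀ i → ∃[ a ] ∃[ b ] (a ≢ b × Adjacent H (c i) (c a) × Adjacent H (c i) (c b))
  around zero = suc zero , fromℕ _ , (λ ()) , next zero , H-sym close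
  around (suc i) with view i
  ... | ‵fromℕ = inject₁ (fromℕ _) , zero , (λ ()) , H-sym (next i) , close
  ... | ‵inject₁ i′ = inject₁ (inject₁ i′) , suc (suc i′) , distinct , H-sym (next i) , next (suc i′)
    where
    distinct : inject₁ (inject₁ i′) ≢ suc (suc i′)
    distinct eq = <⇒≢ (m≤n⇒m≤1+n (n<1+n (toℕ i′)))
      (trans (≡-sym (trans (Fin.toℕ-inject₁ (inject₁ i′)) (Fin.toℕ-inject₁ i′))) (cong toℕ eq))
... | a , b , a≢b , ea , eb = a≢b (inj a b (unique (c i) (c a) (c b) ea eb (lower a ea) (lower b eb)))
  where
  lower : ∀ j → Adjacent H (c i) (c j) → rank (c j) < rank (c i)
  lower j e = ≤∧≢⇒< (max j) (λ eq → differ _ _ e (≡-sym eq))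

open Equivalence using (to; from)

degree≤ : {B : Set} → DecidableEquality B → ∀ H (f : Fin (n H) → B) → (∀ u v → f u ≡ f v → u ≡ v) →
  ∀ v (L : List B) → (∀ u → Adjacent H v u → f u ∈ˡ L) → degree H v ≤ length L
degree≤ _≟_ H f inj v L sub = ∣p∣≤length _≟_ f inj L (neighbourhood H v)
  λ u u∈ → sub u (trans (≡-sym (lookup∘tabulate (adj H v) u)) ([]=⇒lookup u∈))

-- One interface for the abstract comb and for induced subgraphs of `G`. `Valid` is a parameter
-- because the line graph of a comb has no vertex for the root cell.
record Coordinates (H : Graph) (Valid : ℕ × ℕ → Set) (Adj : ℕ × ℕ → ℕ × ℕ → Set) : Set where
  field
    co     : Fin (n H) → ℕ × ℕ
    inj    : ∀ u v → co u ≡ co v → u ≡ v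
    valid  : ∀ u → Valid (co u)
    vertex : ∀ w → Valid w → ∃[ u ] co u ≡ w
    adj⇔   : ∀ u v → Adjacent H u v ⇔ Adj (co u) (co v)

module _ {m ℓ H} (0<m : 0 < m) (C : Coordinates H (Cell m ℓ) CombAdj) where
  open Coordinates C

  private
    height-differs : ∀ u v → Adjacent H u v → height (co u) ≢ height (co v)
    height-differs u v e eq with to (adj⇔ u v) e
    ... | inj₁ p = <⇒≢ (≤-reflexive (Parent-height p)) eq
    ... | inj₂ p = <⇒≢ (≤-reflexive (Parent-height p)) (≡-sym eq)

    lower⇒Parent : ∀ u v → Adjacent H u v → height (co v) < height (co u) → Parent (co v) (co u)
    lower⇒Parent u v e lt with to (adj⇔ u v) e
    ... | inj₁ p = ⊥-elim (<-asym lt (≤-reflexive (Parent-height p)))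
    ... | inj₂ p = p

    parentOf : ∀ u w → Parent w (co u) → ∃[ v ] (co v ≡ w × Adjacent H u v × Adjacent H v u)
    parentOf u w p with vertex w (Parent-Cell p (valid u))
    ... | v , refl = v , refl , from (adj⇔ u v) (inj₂ p) , from (adj⇔ v u) (inj₁ p)

    root : ∃[ u ] co u ≡ (0 , 0)
    root = vertex (0 , 0) (0<m , z≤n)

    is-root : ∀ u → co u ≡ (0 , 0) → u ≡ proj₁ root
    is-root u eq = inj u (proj₁ root) (trans eq (≡-sym (proj₂ root)))

    walk-from : ∀ i j u v → co u ≡ (i , j) → Walk H ⊤ (proj₁ root) v → Walk H ⊤ u v
    walk-from zero zero u v eq w = subst (λ x → Walk H ⊤ x v) (≡-sym (is-root u eq)) w
    walk-from (suc i) zero u v eq w with parentOf u (i , 0) (subst (Parent _) (≡-sym eq) spine)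
    ... | x , eqx , e , _ = step ∈⊤ e (walk-from i 0 x v eqx w)
    walk-from i (suc j) u v eq w with parentOf u (i , j) (subst (Parent _) (≡-sym eq) leg)
    ... | x , eqx , e , _ = step ∈⊤ e (walk-from i j x v eqx w)

    walk-to : ∀ i j u v → co u ≡ (i , j) → Walk H ⊤ u v → Walk H ⊤ (proj₁ root) v
    walk-to zero zero u v eq w = subst (λ x → Walk H ⊤ x v) (is-root u eq) w
    walk-to (suc i) zero u v eq w with parentOf u (i , 0) (subst (Parent _) (≡-sym eq) spine)
    ... | x , eqx , _ , e = walk-to i 0 x v eqx (step ∈⊤ e w)
    walk-to i (suc j) u v eq w with parentOf u (i , j) (subst (Parent _) (≡-sym eq) leg)
    ... | x , eqx , _ , e = walk-to i j x v eqx (step ∈⊤ e w)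

    tree : Tree H
    tree = (λ u v _ _ → walk-from _ _ u v refl (walk-to _ _ v v refl (here ∈⊤)))
      , acyclic H (height ∘ co) height-differs λ u v w ev ew lv lw →
          inj v w (Parent-unique (lower⇒Parent u v ev lv) (lower⇒Parent u w ew lw))

    neighbours : ℕ × ℕ → List (ℕ × ℕ)
    neighbours (i , suc j) = (i , j) ∷ (i , suc (suc j)) ∷ []
    -- For `i` = 0 the last entry is the cell itself; the list only has to bound the degree from
    -- above.
    neighbours (i , zero) = (i , 1) ∷ (suc i , 0) ∷ (i ∸ 1 , 0) ∷ []

    ∈-neighbours : ∀ {w w′} → CombAdj w w′ → w′ ∈ˡ neighbours w
    ∈-neighbours {_ , zero} (inj₁ leg) = here refl
    ∈-neighbours {_ , suc j} (inj₁ leg) = there (here refl)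
    ∈-neighbours (inj₁ spine) = there (here refl)
    ∈-neighbours (inj₂ leg) = here refl
    ∈-neighbours (inj₂ spine) = there (there (here refl))

    degree≤neighbours : ∀ v → degree H v ≤ length (neighbours (co v))
    degree≤neighbours v = degree≤ _≟²_ H co inj v _ λ u e → ∈-neighbours (to (adj⇔ v u) e)

    degree≤3 : ∀ v → degree H v ≤ 3
    degree≤3 v = ≤-trans (degree≤neighbours v) (bound (co v))
      where
      bound : ∀ w → length (neighbours w) ≤ 3
      bound (i , zero) = ≤-refl
      bound (i , suc j) = s≤s (s≤s z≤n)

    spineVertex : (i : Fin m) → ∃[ u ] co u ≡ (toℕ i , 0)
    spineVertex i = vertex (toℕ i , 0) (Fin.toℕ<n i , z≤n)

    spine-injective : Injective (proj₁ ∘ spineVertex)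
    spine-injective i j eq = Fin.toℕ-injective (cong proj₁
      (trans (≡-sym (proj₂ (spineVertex i))) (trans (cong co eq) (proj₂ (spineVertex j)))))

    CombAdj⇔consecutive : ∀ {i j} → CombAdj (i , 0) (j , 0) ⇔ (suc i ≡ j ⊎ suc j ≡ i)
    CombAdj⇔consecutive = mk⇔
      (λ { (inj₁ spine) → inj₁ refl ; (inj₂ spine) → inj₂ refl })
      (λ { (inj₁ refl) → inj₁ spine ; (inj₂ refl) → inj₂ spine })

    spine-path : IsPath (induced H m (proj₁ ∘ spineVertex))
    spine-path = 0<m , ↔-id _ , λ i j →
      let adjacency = subst₂ (λ w w′ → Adjacent H (proj₁ (spineVertex i)) (proj₁ (spineVertex j)) ⇔ CombAdj w w′)
                        (proj₂ (spineVertex i)) (proj₂ (spineVertex j)) (adj⇔ _ _)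
      in mk⇔ (to CombAdj⇔consecutive ∘ to adjacency) (from adjacency ∘ from CombAdj⇔consecutive)

    branch-on-spine : ∀ v → 2 < degree H v → ∃[ i ] proj₁ (spineVertex i) ≡ v
    branch-on-spine v 2< = go (co v) refl
      where
      go : ∀ w → co v ≡ w → ∃[ i ] proj₁ (spineVertex i) ≡ v
      go (i , suc j) eq = ⊥-elim (<⇒≱ 2< (subst (λ w → degree H v ≤ length (neighbours w)) eq (degree≤neighbours v)))
      go (i , zero) eq with toFin (subst (λ w → proj₁ w < m) eq (proj₁ (valid v)))
      ... | i′ , refl = i′ , inj _ v (trans (proj₂ (spineVertex i′)) (≡-sym eq))

  -- Every cell has at most one neighbour of smaller height, so `acyclic` applies; a cell of a leg
  -- has at most two neighbours, so the branch vertices are all on the spine.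
  comb-caterpillar : Caterpillar H
  comb-caterpillar = tree , degree≤3 , m , proj₁ ∘ spineVertex , spine-injective , spine-path , branch-on-spine

-- The caterpillar of which an induced subgraph is to be the line graph need not occur in `G`, so it
-- is built here.
combGraph : ℕ → (ℕ → ℕ) → Graph
combGraph m ℓ = record
  { n = total m ℓ
  ; adj = λ u v → does (CombAdj? (cell m ℓ u) (cell m ℓ v))
  ; sym = λ u v → does-⇔ (mk⇔ swap swap) (CombAdj? (cell m ℓ u) (cell m ℓ v)) (CombAdj? (cell m ℓ v) (cell m ℓ u))
  ; irrefl = λ v → dec-false (CombAdj? (cell m ℓ v) (cell m ℓ v)) [ not-self , not-self ]
  }
  where
  not-self : ∀ {w} → ¬ Parent w w
  not-self p = <⇒≢ (≤-reflexive (Parent-height p)) refl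

does⇔ : ∀ {P : Set} (p? : Dec P) → (does p? ≡ true) ⇔ P
does⇔ (yes p) = mk⇔ (λ _ → p) (λ _ → refl)
does⇔ (no ¬p) = mk⇔ (λ ()) (λ p → ⊥-elim (¬p p))

combGraph-coordinates : ∀ m ℓ → Coordinates (combGraph m ℓ) (Cell m ℓ) CombAdj
combGraph-coordinates m ℓ = record
  { co = cell m ℓ ; inj = cell-injective m ℓ ; valid = cell-Cell m ℓ ; vertex = cell-at m ℓ
  ; adj⇔ = λ u v → does⇔ (CombAdj? (cell m ℓ u) (cell m ℓ v)) }

NonRoot : ℕ → (ℕ → ℕ) → ℕ × ℕ → Set
NonRoot m ℓ w = Cell m ℓ w × w ≢ (0 , 0)

hasParent : ∀ w → w ≢ (0 , 0) → ∃[ a ] Parent a w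
hasParent (zero , zero) ≢0 = ⊥-elim (≢0 refl)
hasParent (suc i , zero) _ = (i , 0) , spine
hasParent (i , suc j) _ = (i , j) , leg

SharesEnd² : (ℕ × ℕ) × (ℕ × ℕ) → (ℕ × ℕ) × (ℕ × ℕ) → Set
SharesEnd² (a , b) (c , d) = a ≡ c ⊎ a ≡ d ⊎ b ≡ c ⊎ b ≡ d

LineAdj⇒SharesEnd : ∀ {a w b w′} → Parent a w → Parent b w′ → LineAdj w w′ → w ≢ w′ × SharesEnd² (a , w) (b , w′)
LineAdj⇒SharesEnd p q (inj₁ (inj₁ r)) = (λ { refl → <⇒≢ (≤-reflexive (Parent-height r)) refl }) , inj₂ (inj₂ (inj₁ (Parent-unique r q)))
LineAdj⇒SharesEnd p q (inj₁ (inj₂ r)) = (λ { refl → <⇒≢ (≤-reflexive (Parent-height r)) refl }) , inj₂ (inj₁ (Parent-unique p r))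
LineAdj⇒SharesEnd leg spine (inj₂ (inj₁ siblings)) = (λ ()) , inj₁ refl
LineAdj⇒SharesEnd spine leg (inj₂ (inj₂ siblings)) = (λ ()) , inj₁ refl

SharesEnd⇒LineAdj : ∀ {a w b w′} → Parent a w → Parent b w′ → w ≢ w′ → SharesEnd² (a , w) (b , w′) → LineAdj w w′
SharesEnd⇒LineAdj leg leg ≢w (inj₁ refl) = ⊥-elim (≢w refl)
SharesEnd⇒LineAdj leg spine ≢w (inj₁ refl) = inj₂ (inj₁ siblings)
SharesEnd⇒LineAdj spine leg ≢w (inj₁ refl) = inj₂ (inj₂ siblings)
SharesEnd⇒LineAdj spine spine ≢w (inj₁ refl) = ⊥-elim (≢w refl)
SharesEnd⇒LineAdj p q ≢w (inj₂ (inj₁ refl)) = inj₁ (inj₂ p)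
SharesEnd⇒LineAdj p q ≢w (inj₂ (inj₂ (inj₁ refl))) = inj₁ (inj₁ q)
SharesEnd⇒LineAdj p q ≢w (inj₂ (inj₂ (inj₂ refl))) = ⊥-elim (≢w refl)

module _ {G : Graph} (m : ℕ) (ℓ : ℕ → ℕ) (f : Fin (ℓ 0 + total m (ℓ ∘ suc)) → Fin (n G))
  (adjacency : ∀ u v → Adjacent G (f u) (f v) ⇔ LineAdj (cell (suc m) ℓ (suc u)) (cell (suc m) ℓ (suc v))) where

  private
    T : Graph
    T = combGraph (suc m) ℓ

    at : Fin (n T) → ℕ × ℕ
    at = cell (suc m) ℓ

    at-injective : ∀ {u v} → at u ≡ at v → u ≡ v
    at-injective {u} {v} = cell-injective (suc m) ℓ u v

    nonroot : ∀ (i : Fin (ℓ 0 + total m (ℓ ∘ suc))) → at (suc i) ≢ (0 , 0)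
    nonroot i eq with at-injective {suc i} {zero} eq
    ... | ()

    parentIndex : ∀ i → ∃[ a ] Parent (at a) (at (suc i))
    parentIndex i with hasParent (at (suc i)) (nonroot i)
    ... | w , p with cell-at (suc m) ℓ w (Parent-Cell p (cell-Cell (suc m) ℓ (suc i)))
    ...   | a , refl = a , p

    edge : ∀ i → Fin (n T) × Fin (n T)
    edge i = proj₁ (parentIndex i) , suc i

    SharesEnd⇔ : ∀ a b c d → SharesEnd² (at a , at b) (at c , at d) ⇔ SharesEnd (a , b) (c , d)
    SharesEnd⇔ a b c d = mk⇔
      (λ { (inj₁ eq) → inj₁ (at-injective eq) ; (inj₂ (inj₁ eq)) → inj₂ (inj₁ (at-injective eq))
         ; (inj₂ (inj₂ (inj₁ eq))) → inj₂ (inj₂ (inj₁ (at-injective eq)))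
         ; (inj₂ (inj₂ (inj₂ eq))) → inj₂ (inj₂ (inj₂ (at-injective eq))) })
      (λ { (inj₁ refl) → inj₁ refl ; (inj₂ (inj₁ refl)) → inj₂ (inj₁ refl)
         ; (inj₂ (inj₂ (inj₁ refl))) → inj₂ (inj₂ (inj₁ refl))
         ; (inj₂ (inj₂ (inj₂ refl))) → inj₂ (inj₂ (inj₂ refl)) })

    edge-proper : ∀ i → toℕ (proj₁ (edge i)) < toℕ (proj₂ (edge i)) × Adjacent T (proj₁ (edge i)) (proj₂ (edge i))
    edge-proper i with parentIndex i
    ... | a , p = Parent⇒< (suc m) ℓ a (suc i) p , from (does⇔ (CombAdj? (at a) (at (suc i)))) (inj₁ p)

    edge-complete : ∀ a b → toℕ a < toℕ b → Adjacent T a b → ∃[ i ] edge i ≡ (a , b)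
    edge-complete a b lt e with to (does⇔ (CombAdj? (at a) (at b))) e
    ... | inj₂ p = ⊥-elim (<-asym lt (Parent⇒< (suc m) ℓ b a p))
    edge-complete a (suc i) lt e | inj₁ p =
      i , cong (_, suc i) (at-injective (Parent-unique (proj₂ (parentIndex i)) p))

  -- An edge of the comb is named by its lower end. The root cell comes first in the enumeration, so
  -- the edges are exactly the indices `suc i`.
  comb-lineGraph : IsLineGraphOfCaterpillar (induced G _ f)
  comb-lineGraph = T , comb-caterpillar (s≤s z≤n) (combGraph-coordinates (suc m) ℓ) , edge , edge-proper
    , (λ i j eq → Fin.suc-injective (cong proj₂ eq)) , edge-complete
    , λ i j → mk⇔
        (λ e → let ≢w , sh = LineAdj⇒SharesEnd (proj₂ (parentIndex i)) (proj₂ (parentIndex j)) (to (adjacency i j) e)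
               in (λ { refl → ≢w refl }) , to (SharesEnd⇔ _ _ _ _) sh)
        (λ { (i≢j , sh) → from (adjacency i j) (SharesEnd⇒LineAdj (proj₂ (parentIndex i)) (proj₂ (parentIndex j))
               (λ eq → i≢j (Fin.suc-injective (at-injective eq))) (from (SharesEnd⇔ _ _ _ _) sh)) })

module _ {G : Graph} (δ : ℕ) (3≤δ : 3 ≤ δ) (ℓ : ℕ → ℕ) (f : Fin (suc (total δ ℓ)) → Fin (n G))
  (centre : ∀ u → Adjacent G (f zero) (f (suc u)) ⇔ (proj₂ (cell δ ℓ u) ≡ 0))
  (legs : ∀ u v → Adjacent G (f (suc u)) (f (suc v)) ⇔ (proj₁ (cell δ ℓ u) ≡ proj₁ (cell δ ℓ v) ×
            (suc (proj₂ (cell δ ℓ u)) ≡ proj₂ (cell δ ℓ v) ⊎ suc (proj₂ (cell δ ℓ v)) ≡ proj₂ (cell δ ℓ u)))) where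

  private
    SV : Set
    SV = StarV δ (ℓ ∘ toℕ)

    toStar : Fin (suc (total δ ℓ)) → SV
    toStar zero = inj₁ tt
    toStar (suc u) = inj₂ (finCell δ ℓ u)

    fromStar : SV → Fin (suc (total δ ℓ))
    fromStar (inj₁ tt) = zero
    fromStar (inj₂ c) = suc (position δ ℓ c)

    star-bijection : Fin (suc (total δ ℓ)) ↔ SV
    star-bijection = mk↔ₛ′ toStar fromStar
      (λ { (inj₁ tt) → refl ; (inj₂ c) → cong inj₂ (finCell-position δ ℓ c) })
      (λ { zero → refl ; (suc u) → cong suc (position-finCell δ ℓ u) })

    consecutive : ∀ {k} (j j′ : Fin (suc k)) → suc (toℕ j) ≡ toℕ j′ →
      ∃[ j₀ ] (inject₁ j₀ ≡ j × Data.Fin.suc j₀ ≡ j′)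
    consecutive j (suc j′) eq =
      j′ , Fin.toℕ-injective (trans (Fin.toℕ-inject₁ j′) (≡-sym (suc-injective eq))) , refl

    adjacent-legs : ∀ (c c′ : FinCell δ ℓ) → StarAdj δ (ℓ ∘ toℕ) (inj₂ c) (inj₂ c′) ⇔
      (toℕ (proj₁ c) ≡ toℕ (proj₁ c′) ×
        (suc (toℕ (proj₂ c)) ≡ toℕ (proj₂ c′) ⊎ suc (toℕ (proj₂ c′)) ≡ toℕ (proj₂ c)))
    adjacent-legs (i , j) (i′ , j′) = mk⇔ there-way back-way
      where
      there-way : ∀ {c c′ : FinCell δ ℓ} → StarAdj δ (ℓ ∘ toℕ) (inj₂ c) (inj₂ c′) →
        toℕ (proj₁ c) ≡ toℕ (proj₁ c′) ×
        (suc (toℕ (proj₂ c)) ≡ toℕ (proj₂ c′) ⊎ suc (toℕ (proj₂ c′)) ≡ toℕ (proj₂ c))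
      there-way (forward i j) = refl , inj₁ (cong suc (Fin.toℕ-inject₁ j))
      there-way (backward i j) = refl , inj₂ (cong suc (Fin.toℕ-inject₁ j))
      back-way : toℕ i ≡ toℕ i′ × (suc (toℕ j) ≡ toℕ j′ ⊎ suc (toℕ j′) ≡ toℕ j) →
        StarAdj δ (ℓ ∘ toℕ) (inj₂ (i , j)) (inj₂ (i′ , j′))
      back-way (eq , c) with Fin.toℕ-injective {i = i} {j = i′} eq
      back-way (eq , inj₁ c) | refl with consecutive j j′ c
      ... | j₀ , refl , refl = forward i j₀
      back-way (eq , inj₂ c) | refl with consecutive j′ j c
      ... | j₀ , refl , refl = backward i j₀

    centre-adj : ∀ (c : FinCell δ ℓ) → StarAdj δ (ℓ ∘ toℕ) (inj₁ tt) (inj₂ c) ⇔ (toℕ (proj₂ c) ≡ 0)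
    centre-adj (i , j) = mk⇔ (λ { (centre-leg _) → refl }) (back j)
      where
      back : ∀ j → toℕ j ≡ 0 → StarAdj δ (ℓ ∘ toℕ) (inj₁ tt) (inj₂ (i , j))
      back zero refl = centre-leg i

    adj-centre : ∀ (c : FinCell δ ℓ) → StarAdj δ (ℓ ∘ toℕ) (inj₂ c) (inj₁ tt) ⇔ (toℕ (proj₂ c) ≡ 0)
    adj-centre (i , j) = mk⇔ (λ { (leg-centre _) → refl }) (back j)
      where
      back : ∀ j → toℕ j ≡ 0 → StarAdj δ (ℓ ∘ toℕ) (inj₂ (i , j)) (inj₁ tt)
      back zero refl = leg-centre i

    adjacency : ∀ u v → Adjacent G (f u) (f v) ⇔ StarAdj δ (ℓ ∘ toℕ) (toStar u) (toStar v)
    adjacency zero zero = mk⇔ (λ e → ⊥-elim (true≢false (trans (≡-sym e) (irrefl G (f zero))))) (λ ())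
      where
      true≢false : true ≢ false
      true≢false ()
    adjacency zero (suc v) = mk⇔ (from (centre-adj _) ∘ to (centre v)) (from (centre v) ∘ to (centre-adj _))
    adjacency (suc u) zero = mk⇔
      (λ e → from (adj-centre _) (to (centre u) (trans (Graph.sym G (f zero) (f (suc u))) e)))
      (λ s → trans (Graph.sym G (f (suc u)) (f zero)) (from (centre u) (to (adj-centre _) s)))
    adjacency (suc u) (suc v) = mk⇔ (from (adjacent-legs _ _) ∘ to (legs u v)) (from (legs u v) ∘ to (adjacent-legs _ _))

  star-subdivided : IsSubdividedStar (induced G _ f)
  star-subdivided = δ , 3≤δ , ℓ ∘ toℕ , star-bijection , adjacency

-- Simplicial vertices of combs, their line graphs and stars.

LegEnd : (ℕ → ℕ) → ℕ × ℕ → Set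
LegEnd ℓ (i , j) = 0 < j × j ≡ ℓ i

LegEnd? : ∀ ℓ w → Dec (LegEnd ℓ w)
LegEnd? ℓ (i , j) = (0 <? j) ×-dec (j ≟ ℓ i)

NonAdjacentPair : (ℕ × ℕ → Set) → (ℕ × ℕ → ℕ × ℕ → Set) → ℕ × ℕ → Set
NonAdjacentPair Valid Adj w = ∃[ a ] ∃[ b ] (Valid a × Valid b × Adj w a × Adj w b × a ≢ b × ¬ Adj a b)

-- A row without a leg has `ℓ i` = 0; the condition `0 < j` in `LegEnd` keeps its spine cell from
-- counting as an end. A cell that is no end is refuted by two nonadjacent neighbours.
simplicial⇔LegEnd : ∀ {H Valid Adj} ℓ (C : Coordinates H Valid Adj) →
  (∀ w a b → LegEnd ℓ w → Valid w → Valid a → Valid b → Adj w a → Adj w b → a ≢ b → Adj a b) →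
  (∀ w → Valid w → ¬ LegEnd ℓ w → NonAdjacentPair Valid Adj w) →
  ∀ u → Simplicial H u ⇔ LegEnd ℓ (Coordinates.co C u)
simplicial⇔LegEnd {H} ℓ C ends others u = mk⇔ ⇒ ⇐
  where
  open Coordinates C
  ⇒ : Simplicial H u → LegEnd ℓ (co u)
  ⇒ simp with LegEnd? ℓ (co u)
  ... | yes end = end
  ... | no ¬end with others (co u) (valid u) ¬end
  ...   | a , b , va , vb , wa , wb , a≢b , ¬ab with vertex a va | vertex b vb
  ...     | x , refl | y , refl = ⊥-elim (¬ab (to (adj⇔ x y)
              (simp x y (from (adj⇔ u x) wa) (from (adj⇔ u y) wb) λ { refl → a≢b refl })))
  ⇐ : LegEnd ℓ (co u) → Simplicial H u
  ⇐ end x y ux uy x≢y = from (adj⇔ x y) (ends (co u) (co x) (co y) end (valid u) (valid x) (valid y)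
    (to (adj⇔ u x) ux) (to (adj⇔ u y) uy) (λ eq → x≢y (inj x y eq)))

module _ {μ : ℕ} {ℓ : ℕ → ℕ} (first : 0 < ℓ 0) (last : 0 < ℓ (suc μ)) where

  private
    m : ℕ
    m = suc (suc μ)

  comb-ends : ∀ w a b → LegEnd ℓ w → Cell m ℓ w → Cell m ℓ a → Cell m ℓ b → CombAdj w a → CombAdj w b → a ≢ b → CombAdj a b
  comb-ends (i , suc j) a b (_ , eq) _ ca cb wa wb a≢b = ⊥-elim (a≢b (trans (only a ca wa) (≡-sym (only b cb wb))))
    where
    only : ∀ a → Cell m ℓ a → CombAdj (i , suc j) a → a ≡ (i , j)
    only _ (_ , j≤) (inj₁ leg) = ⊥-elim (<⇒≱ j≤ (≤-reflexive (≡-sym eq)))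
    only _ _ (inj₂ leg) = refl

  -- This is where `first` and `last` enter: an end of the spine without a leg would be a leaf,
  -- hence simplicial.
  comb-others : ∀ w → Cell m ℓ w → ¬ LegEnd ℓ w → NonAdjacentPair (Cell m ℓ) CombAdj w
  comb-others (i , suc j) (i< , j≤) ¬end = (i , j) , (i , suc (suc j)) , (i< , <⇒≤ j≤)
    , (i< , ≤∧≢⇒< j≤ (λ eq → ¬end (s≤s z≤n , eq))) , inj₂ leg , inj₁ leg , (λ ()) , λ { (inj₁ ()) ; (inj₂ ()) }
  comb-others (i , zero) (i< , j≤) ¬end with 0 <? ℓ i
  comb-others (zero , zero) (i< , j≤) ¬end | yes 0<ℓ = (0 , 1) , (1 , 0) , (i< , 0<ℓ) , (s≤s (s≤s z≤n) , z≤n)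
    , inj₁ leg , inj₁ spine , (λ ()) , λ { (inj₁ ()) ; (inj₂ ()) }
  comb-others (suc i , zero) (i< , j≤) ¬end | yes 0<ℓ = (suc i , 1) , (i , 0) , (i< , 0<ℓ) , (<⇒≤ i< , z≤n)
    , inj₁ leg , inj₂ spine , (λ ()) , λ { (inj₁ ()) ; (inj₂ ()) }
  comb-others (zero , zero) (i< , j≤) ¬end | no ≮ = ⊥-elim (≮ first)
  comb-others (suc i , zero) (i< , j≤) ¬end | no ≮ = (i , 0) , (suc (suc i) , 0) , (<⇒≤ i< , z≤n)
    , (≤∧≢⇒< i< (λ { refl → ≮ last }) , z≤n) , inj₂ spine , inj₁ spine , (λ ()) , λ { (inj₁ ()) ; (inj₂ ()) }

  -- A leg of length one ends in a triangle: its only possible neighbours are (i , 0) and (suc i ,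
  -- 0), which are adjacent. A longer leg ends in a vertex of degree one.
  line-ends : ∀ w a b → LegEnd ℓ w → NonRoot m ℓ w → NonRoot m ℓ a → NonRoot m ℓ b → LineAdj w a → LineAdj w b → a ≢ b → LineAdj a b
  line-ends (i , suc j) a b (_ , eq) _ ((_ , j≤) , _) _ (inj₁ (inj₁ leg)) _ _ = ⊥-elim (<⇒≱ j≤ (≤-reflexive (≡-sym eq)))
  line-ends (i , suc j) a b (_ , eq) _ _ ((_ , j≤) , _) _ (inj₁ (inj₁ leg)) _ = ⊥-elim (<⇒≱ j≤ (≤-reflexive (≡-sym eq)))
  line-ends (i , suc j) a b _ _ _ _ (inj₁ (inj₂ leg)) (inj₁ (inj₂ leg)) a≢b = ⊥-elim (a≢b refl)
  line-ends (i , suc j) a b _ _ _ _ (inj₁ (inj₂ leg)) (inj₂ (inj₁ siblings)) _ = inj₁ (inj₁ spine)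
  line-ends (i , suc j) a b _ _ _ _ (inj₂ (inj₁ siblings)) (inj₁ (inj₂ leg)) _ = inj₁ (inj₂ spine)
  line-ends (i , suc j) a b _ _ _ _ (inj₂ (inj₁ siblings)) (inj₂ (inj₁ siblings)) a≢b = ⊥-elim (a≢b refl)

  -- A spine cell sees something on either side. With the root cell absent, the leg of row 0
  -- continues the spine to the left of (1 , 0); in the last row the leg replaces the missing
  -- successor.
  line-others : ∀ w → NonRoot m ℓ w → ¬ LegEnd ℓ w → NonAdjacentPair (NonRoot m ℓ) LineAdj w
  line-others (i , suc j) ((i< , j≤) , _) ¬end = lower i j i< j≤ (≤∧≢⇒< j≤ (λ eq → ¬end (s≤s z≤n , eq)))
    where
    lower : ∀ i j → i < m → suc j ≤ ℓ i → suc (suc j) ≤ ℓ i → NonAdjacentPair (NonRoot m ℓ) LineAdj (i , suc j)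
    lower zero zero i< j≤ j< = (1 , 0) , (0 , 2) , ((s≤s (s≤s z≤n) , z≤n) , λ ()) , ((i< , j<) , λ ())
      , inj₂ (inj₁ siblings) , inj₁ (inj₁ leg) , (λ ())
      , λ { (inj₁ (inj₁ ())) ; (inj₁ (inj₂ ())) ; (inj₂ (inj₁ ())) ; (inj₂ (inj₂ ())) }
    lower (suc i) zero i< j≤ j< = (suc i , 0) , (suc i , 2) , ((i< , z≤n) , λ ()) , ((i< , j<) , λ ())
      , inj₁ (inj₂ leg) , inj₁ (inj₁ leg) , (λ ())
      , λ { (inj₁ (inj₁ ())) ; (inj₁ (inj₂ ())) ; (inj₂ (inj₁ ())) ; (inj₂ (inj₂ ())) }
    lower i (suc j) i< j≤ j< = (i , suc j) , (i , suc (suc (suc j))) , ((i< , <⇒≤ j≤) , λ ()) , ((i< , j<) , λ ())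
      , inj₁ (inj₂ leg) , inj₁ (inj₁ leg) , (λ ())
      , λ { (inj₁ (inj₁ ())) ; (inj₁ (inj₂ ())) ; (inj₂ (inj₁ ())) ; (inj₂ (inj₂ ())) }
  line-others (zero , zero) (_ , ≢0) ¬end = ⊥-elim (≢0 refl)
  line-others (suc i , zero) ((i< , j≤) , _) ¬end = combine (before i i<) after
    where
    Before : ℕ → ℕ × ℕ → Set
    Before i a = a ≡ (0 , 1) × i ≡ 0 ⊎ ∃[ i′ ] (i ≡ suc i′ × a ≡ (i , 0))
    before : ∀ i → suc i < m → ∃[ a ] (NonRoot m ℓ a × LineAdj (suc i , 0) a × Before i a)
    before zero i< = (0 , 1) , ((s≤s z≤n , first) , λ ()) , inj₂ (inj₂ siblings) , inj₁ (refl , refl)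
    before (suc i) i< = (suc i , 0) , ((<⇒≤ i< , z≤n) , λ ()) , inj₁ (inj₂ spine) , inj₂ (i , refl , refl)
    After : ℕ × ℕ → Set
    After b = b ≡ (suc (suc i) , 0) ⊎ b ≡ (suc i , 1)
    after : ∃[ b ] (NonRoot m ℓ b × LineAdj (suc i , 0) b × After b)
    after with suc (suc i) <? m
    ... | yes lt = (suc (suc i) , 0) , ((lt , z≤n) , λ ()) , inj₁ (inj₁ spine) , inj₁ refl
    ... | no ≮ with suc-injective (≤-antisym i< (≮⇒≥ ≮))
    ...   | refl = (suc i , 1) , ((i< , last) , λ ()) , inj₁ (inj₁ leg) , inj₂ refl
    combine : ∃[ a ] (NonRoot m ℓ a × LineAdj (suc i , 0) a × Before i a) →
      ∃[ b ] (NonRoot m ℓ b × LineAdj (suc i , 0) b × After b) → NonAdjacentPair (NonRoot m ℓ) LineAdj (suc i , 0)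
    combine (a , va , wa , sa) (b , vb , wb , sb) = a , b , va , vb , wa , wb , distinct sa sb , apart sa sb
      where
      distinct : ∀ {a b} → Before i a → After b → a ≢ b
      distinct (inj₁ (refl , refl)) (inj₁ refl) ()
      distinct (inj₁ (refl , refl)) (inj₂ refl) ()
      distinct (inj₂ (_ , refl , refl)) (inj₁ refl) ()
      distinct (inj₂ (_ , refl , refl)) (inj₂ refl) ()
      apart : ∀ {a b} → Before i a → After b → ¬ LineAdj a b
      apart (inj₁ (refl , refl)) (inj₁ refl) = λ { (inj₁ (inj₁ ())) ; (inj₁ (inj₂ ())) ; (inj₂ (inj₁ ())) ; (inj₂ (inj₂ ())) }
      apart (inj₁ (refl , refl)) (inj₂ refl) = λ { (inj₁ (inj₁ ())) ; (inj₁ (inj₂ ())) ; (inj₂ (inj₁ ())) ; (inj₂ (inj₂ ())) }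
      apart (inj₂ (_ , refl , refl)) (inj₁ refl) = λ { (inj₁ (inj₁ ())) ; (inj₁ (inj₂ ())) ; (inj₂ (inj₁ ())) ; (inj₂ (inj₂ ())) }
      apart (inj₂ (_ , refl , refl)) (inj₂ refl) = λ { (inj₁ (inj₁ ())) ; (inj₁ (inj₂ ())) ; (inj₂ (inj₁ ())) ; (inj₂ (inj₂ ())) }

module _ {G : Graph} {N δ : ℕ} {ℓ : ℕ → ℕ} (co : Fin N → ℕ × ℕ) (inj : ∀ u v → co u ≡ co v → u ≡ v)
  (valid : ∀ u → Cell δ ℓ (co u)) (at : ∀ w → Cell δ ℓ w → ∃[ u ] co u ≡ w) (2≤δ : 2 ≤ δ)
  (f : Fin (suc N) → Fin (n G))
  (centre : ∀ u → Adjacent G (f zero) (f (suc u)) ⇔ (proj₂ (co u) ≡ 0))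
  (legs : ∀ u v → Adjacent G (f (suc u)) (f (suc v)) ⇔ (proj₁ (co u) ≡ proj₁ (co v) ×
            (suc (proj₂ (co u)) ≡ proj₂ (co v) ⊎ suc (proj₂ (co v)) ≡ proj₂ (co u)))) where

  private
    H : Graph
    H = induced G (suc N) f

    H-sym : ∀ {u v} → Adjacent H u v → Adjacent H v u
    H-sym {u} {v} e = trans (Graph.sym H v u) e

    centre-not-simplicial : ¬ Simplicial H zero
    centre-not-simplicial sc =
      let a , eqa = at (0 , 0) (≤-trans (s≤s z≤n) 2≤δ , z≤n)
          b , eqb = at (1 , 0) (2≤δ , z≤n)
          a≢b = λ eq → 0≢1+n (cong proj₁ (trans (≡-sym eqa) (trans (cong co (Fin.suc-injective eq)) eqb)))
          eq , _ = to (legs a b) (sc (suc a) (suc b) (from (centre a) (cong proj₂ eqa)) (from (centre b) (cong proj₂ eqb)) a≢b)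
      in 0≢1+n (trans (≡-sym (cong proj₁ eqa)) (trans eq (cong proj₁ eqb)))

    module _ (u : Fin N) where

      i j : ℕ
      i = proj₁ (co u)
      j = proj₂ (co u)

      inward : j ≡ ℓ i → ∀ z → Adjacent H (suc u) (suc z) → i ≡ proj₁ (co z) × suc (proj₂ (co z)) ≡ j
      inward end z e with to (legs u z) e
      ... | eq , inj₂ k = eq , k
      ... | eq , inj₁ k = ⊥-elim (<⇒≱ (≤-reflexive (trans (cong suc (≡-sym (trans end (cong ℓ eq)))) k)) (proj₂ (valid z)))

      only : j ≡ ℓ i → ∀ x y → Adjacent H (suc u) x → Adjacent H (suc u) y → x ≡ y
      only end zero zero _ _ = refl
      only end zero (suc z) e e′ =
        ⊥-elim (0≢1+n (trans (≡-sym (to (centre u) (H-sym {suc u} {zero} e))) (≡-sym (proj₂ (inward end z e′)))))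
      only end (suc z) zero e e′ =
        ⊥-elim (0≢1+n (trans (≡-sym (to (centre u) (H-sym {suc u} {zero} e′))) (≡-sym (proj₂ (inward end z e)))))
      only end (suc z) (suc z′) e e′ with inward end z e | inward end z′ e′
      ... | eqi , eqj | eqi′ , eqj′ = cong suc (inj z z′
              (cong₂ _,_ (trans (≡-sym eqi) eqi′) (suc-injective (trans eqj (≡-sym eqj′)))))

      inner-not-simplicial : j ≢ ℓ i → ¬ Simplicial H (suc u)
      inner-not-simplicial j≢ sc = inner j refl
        where
        outer : ∃[ a ] co a ≡ (i , suc j)
        outer = at (i , suc j) (proj₁ (valid u) , ≤∧≢⇒< (proj₂ (valid u)) j≢)
        a = proj₁ outer
        a-row : proj₁ (co a) ≡ i
        a-row = cong proj₁ (proj₂ outer)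
        a-col : proj₂ (co a) ≡ suc j
        a-col = cong proj₂ (proj₂ outer)
        ua : Adjacent H (suc u) (suc a)
        ua = from (legs u a) (≡-sym a-row , inj₁ (≡-sym a-col))
        inner : ∀ j₀ → j ≢ j₀
        inner zero j≡ = 0≢1+n (trans
          (≡-sym (to (centre a) (sc zero (suc a) (H-sym {zero} {suc u} (from (centre u) j≡)) ua λ ()))) a-col)
        inner (suc j₀) j≡ with at (i , j₀) (proj₁ (valid u) , <⇒≤ (subst (_≤ ℓ i) j≡ (proj₂ (valid u))))
        ... | b , eqb with to (legs a b) (sc (suc a) (suc b) ua
                (from (legs u b) (≡-sym (cong proj₁ eqb) , inj₂ (trans (cong suc (cong proj₂ eqb)) (≡-sym j≡))))
                λ eq → <⇒≢ (m≤n⇒m≤1+n (n<1+n j₀)) (trans (≡-sym (cong proj₂ eqb))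
                  (trans (cong (proj₂ ∘ co) (≡-sym (Fin.suc-injective eq))) (trans a-col (cong suc j≡)))))
        ...   | _ , inj₁ k = <⇒≢ (m≤n⇒m≤1+n (m≤n⇒m≤1+n (n<1+n j₀))) (trans (≡-sym (cong proj₂ eqb))
                  (trans (≡-sym k) (cong suc (trans a-col (cong suc j≡)))))
        ...   | _ , inj₂ k = <⇒≢ (n<1+n (suc j₀))
                  (trans (cong suc (≡-sym (cong proj₂ eqb))) (trans k (trans a-col (cong suc j≡))))

  -- Column 0 already belongs to a leg here, so a leg of one vertex ends in column 0. The centre
  -- sees the feet of two different legs, which are nonadjacent.
  star-simplicial⇔ : ∀ u → Simplicial H u ⇔ (∃[ u′ ] (u ≡ suc u′ × proj₂ (co u′) ≡ ℓ (proj₁ (co u′))))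
  star-simplicial⇔ zero = mk⇔ (λ sc → ⊥-elim (centre-not-simplicial sc)) λ { (_ , () , _) }
  star-simplicial⇔ (suc u) = mk⇔ ⇒ (λ { (_ , refl , end) x y ux uy x≢y → ⊥-elim (x≢y (only u end x y ux uy)) })
    where
    ⇒ : Simplicial H (suc u) → ∃[ u′ ] (suc u ≡ suc u′ × proj₂ (co u′) ≡ ℓ (proj₁ (co u′)))
    ⇒ sc with proj₂ (co u) ≟ ℓ (proj₁ (co u))
    ... | yes end = u , refl , end
    ... | no j≢ = ⊥-elim (inner-not-simplicial u j≢ sc)

-- From legs attached to a path to the conclusion.

module _ {I A : Set} {T : I → Set} (f : ∀ {i} → T i → A) where

  collect : ∀ {is} → All T is → List A
  collect [] = []
  collect (t ∷ ts) = f t ∷ collect ts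

  collect-length : ∀ {is} (ts : All T is) → length (collect ts) ≡ length is
  collect-length [] = refl
  collect-length (t ∷ ts) = cong suc (collect-length ts)

  collect-All : ∀ {Q : A → Set} → (∀ {i} (t : T i) → Q (f t)) → ∀ {is} (ts : All T is) → All Q (collect ts)
  collect-All q [] = []
  collect-All q (t ∷ ts) = q t ∷ collect-All q ts

  collect-Unique : ∀ {R : I → I → Set} → (∀ {i j} → R i j → (t : T i) (t′ : T j) → f t ≢ f t′) →
    ∀ {is} → AllPairs R is → (ts : All T is) → Unique (collect ts)
  collect-Unique apart [] [] = []
  collect-Unique {R} apart (r ∷ rs) (t ∷ ts) = away r ts ∷ collect-Unique apart rs ts
    where
    away : ∀ {js} → All (R _) js → (ts : All T js) → All (f t ≢_) (collect ts)
    away [] [] = []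
    away (r ∷ rs) (t′ ∷ ts) = apart r t t′ ∷ away rs ts

  collect-∈⁺ : ∀ {is} (ts : All T is) {i} (i∈ : i ∈ˡ is) → f (All.lookup ts i∈) ∈ˡ collect ts
  collect-∈⁺ (t ∷ ts) (here refl) = here refl
  collect-∈⁺ (t ∷ ts) (there i∈) = there (collect-∈⁺ ts i∈)

  collect-∈⁻ : ∀ {is} (ts : All T is) {a} → a ∈ˡ collect ts → ∃[ i ] Σ (T i) λ t → a ≡ f t
  collect-∈⁻ (t ∷ ts) (here refl) = _ , t , refl
  collect-∈⁻ (t ∷ ts) (there a∈) = collect-∈⁻ ts a∈

cliqueOf : ∀ (G : Graph) {xs : List (Fin (n G))} → AllPairs (Adjacent G) xs → HasCliqueOfSize G (length xs)
cliqueOf G {xs} clique = setOf xs , ∣setOf∣ (AllPairs.map ~-irrefl clique)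
  , λ x y x∈ y∈ → AllPairs-∈ ~-sym clique (∈-setOf⁻ xs x∈) (∈-setOf⁻ xs y∈)
  where open Layers G

Consecutive : ℕ → ℕ → Set
Consecutive i j = suc i ≡ j ⊎ suc j ≡ i

Conclusion : (h : ℕ) (G : Graph) → Subset (n G) → Set
Conclusion h G S = Σ (Subset (n G)) λ S̃ → S̃ ⊆ S × ∣ S̃ ∣ ≡ h ×
  (∃[ k ] Σ (Fin k → Fin (n G)) λ f → Injective f × (∀ i → f i ∉ S) × Outcome G S̃ k f)

module Assembly (h : ℕ) (G : Graph) (S : Subset (n G)) where

  open Layers G

  path-conclusion : ∀ (q : ℕ → V) m → (∀ {i} → i ≤ m → q i ∉ S) →
    (∀ {i j} → i ≤ m → j ≤ m → q i ≡ q j → i ≡ j) →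
    (∀ {i j} → i ≤ m → j ≤ m → q i ~ q j ⇔ Consecutive i j) →
    ∀ (ss : List V) → Unique ss → length ss ≡ h → All (_∈ S) ss → All (λ s → ∃[ i ] (i ≤ m × s ~ q i)) ss →
    Conclusion h G S
  path-conclusion q m q∉ q-inj q-adj ss uniq len ss∈ attached =
    setOf ss , (λ s∈ → All.lookup ss∈ (∈-setOf⁻ ss s∈)) , trans (∣setOf∣ uniq) len
    , suc m , q ∘ toℕ
    , (λ i j eq → Fin.toℕ-injective (q-inj (i≤m i) (i≤m j) eq))
    , (λ i → q∉ (i≤m i))
    , inj₁ ((s≤s z≤n , ↔-id _ , λ i j → q-adj (i≤m i) (i≤m j)) , λ s s∈ → hit (All.lookup attached (∈-setOf⁻ ss s∈)))
    where
    i≤m : ∀ (i : Fin (suc m)) → toℕ i ≤ m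
    i≤m i = ≤-pred (Fin.toℕ<n i)
    hit : ∀ {s} → ∃[ i ] (i ≤ m × s ~ q i) → ∃[ i ] Adjacent G s (q (toℕ {suc m} i))
    hit (i , i≤ , e) with toFin (s≤s i≤)
    ... | i′ , refl = i′ , e

  -- Common exit for the three shapes of outcome (ii). The relation `Tip` matches the selected
  -- indices with the simplicial vertices; together with `near` it yields the unique neighbours, the
  -- description of the simplicial set, and also that the terms are distinct, since two equal terms
  -- would be near the same tip.
  attached-conclusion : ∀ {k} {f : Fin k → V} → Injective f → (∀ u → f u ∉ S) →
    (Caterpillar (induced G k f) ⊎ IsLineGraphOfCaterpillar (induced G k f) ⊎ IsSubdividedStar (induced G k f)) →
    ∀ {I : Set} (sel : List I) → Unique sel → length sel ≡ h →
    (term : ∀ {i} → i ∈ˡ sel → V) → (∀ {i} (i∈ : i ∈ˡ sel) → term i∈ ∈ S) →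
    (Tip : I → Fin k → Set) →
    (∀ {i} → i ∈ˡ sel → ∃[ u ] Tip i u) →
    (∀ {i u v} → Tip i u → Tip i v → u ≡ v) → (∀ {i j u} → Tip i u → Tip j u → i ≡ j) →
    (∀ {i} (i∈ : i ∈ˡ sel) u → term i∈ ~ f u ⇔ Tip i u) →
    (∀ u → Simplicial (induced G k f) u ⇔ (∃[ i ] (i ∈ˡ sel × Tip i u))) →
    Conclusion h G S
  attached-conclusion {f = f} f-inj f∉ shape {I} sel uniq len term term∈ Tip tip tip-unique tip-inj near simp =
    setOf terms , (λ s∈ → let i , i∈ , eq = ∈-terms⁻ s∈ in subst (_∈ S) (≡-sym eq) (term∈ i∈))
    , trans (∣setOf∣ terms-unique) (trans terms-length len)
    , _ , f , f-inj , f∉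
    , inj₂ (shape , unique-neighbour
        , λ u → mk⇔ (λ { (s , s∈ , e) → from (simp u) (let i , i∈ , eq = ∈-terms⁻ s∈
                                                    in i , i∈ , to (near i∈ u) (subst (_~ f u) eq e)) })
                    (λ sc → let i , i∈ , t = to (simp u) sc
                                i∈′ , t∈ = ∈-terms⁺ i∈
                            in term i∈′ , t∈ , from (near i∈′ u) t))
    where
    members : All (_∈ˡ sel) sel
    members = All.tabulate (λ i∈ → i∈)
    terms : List V
    terms = collect term members
    terms-length : length terms ≡ length sel
    terms-length = collect-length term members
    terms-unique : Unique terms
    terms-unique = collect-Unique term apart uniq members
      where
      apart : ∀ {i j} → i ≢ j → (i∈ : i ∈ˡ sel) (j∈ : j ∈ˡ sel) → term i∈ ≢ term j∈
      apart i≢j i∈ j∈ eq with tip i∈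
      ... | x , t = i≢j (tip-inj t (to (near j∈ x) (subst (_~ f x) eq (from (near i∈ x) t))))
    ∈-terms⁻ : ∀ {s} → s ∈ setOf terms → ∃[ i ] Σ (i ∈ˡ sel) λ i∈ → s ≡ term i∈
    ∈-terms⁻ s∈ = collect-∈⁻ term members (∈-setOf⁻ terms s∈)
    ∈-terms⁺ : ∀ {i} → i ∈ˡ sel → Σ (i ∈ˡ sel) λ i∈ → term i∈ ∈ setOf terms
    ∈-terms⁺ i∈ = _ , ∈-setOf⁺ (collect-∈⁺ term members i∈)
    unique-neighbour : ∀ s → s ∈ setOf terms → ∃[ u ] (Adjacent G s (f u) × (∀ v → Adjacent G s (f v) → v ≡ u))
    unique-neighbour s s∈ with ∈-terms⁻ s∈
    ... | i , i∈ , refl with tip i∈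
    ...   | u , t = u , from (near i∈ u) t , λ v e → tip-unique (to (near i∈ v) e) t

  -- `Foot k i` says which spine vertices the first vertex of leg `k` sees. Leaving it abstract lets
  -- caterpillars and line graphs share the whole construction up to the reading of adjacencies.
  record Leg (p : ℕ → V) (lo hi : ℕ) (Foot : ℕ → ℕ → Set) (k : ℕ) : Set where
    field
      {t}     : ℕ
      y       : ℕ → V
      s       : V
      s∈      : s ∈ S
      y∉      : ∀ {j} → j ≤ t → y j ∉ S
      y-inj   : ∀ {i j} → i ≤ t → j ≤ t → y i ≡ y j → i ≡ j
      y-adj   : ∀ {i j} → i ≤ t → j ≤ t → y i ~ y j ⇔ Consecutive i j
      s-tip   : ∀ {j} → j ≤ t → s ~ y j ⇔ (j ≡ t)
      s-spine : ∀ {i} → lo ≤ i → i ≤ hi → ¬ s ~ p i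
      foot    : ∀ {j i} → j ≤ t → lo ≤ i → i ≤ hi → y j ~ p i ⇔ (j ≡ 0 × Foot k i)
      y-spine : ∀ {j i} → j ≤ t → lo ≤ i → i ≤ hi → y j ≢ p i

  record Apart {p lo hi Foot k k′} (L : Leg p lo hi Foot k) (L′ : Leg p lo hi Foot k′) : Set where
    private
      module L = Leg L
      module L′ = Leg L′
    field
      y≢ : ∀ {i j} → i ≤ L.t → j ≤ L′.t → L.y i ≢ L′.y j
      y≁ : ∀ {i j} → i ≤ L.t → j ≤ L′.t → ¬ L.y i ~ L′.y j
      s≁ : ∀ {j} → j ≤ L′.t → ¬ L.s ~ L′.y j

  module Legs {p : ℕ → V} {lo μ : ℕ} {Foot : ℕ → ℕ → Set}
    (p∉ : ∀ {i} → lo ≤ i → i ≤ lo + suc μ → p i ∉ S)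
    (p-inj : ∀ {i j} → lo ≤ i → i ≤ lo + suc μ → lo ≤ j → j ≤ lo + suc μ → p i ≡ p j → i ≡ j)
    (p-adj : ∀ {i j} → lo ≤ i → i ≤ lo + suc μ → lo ≤ j → j ≤ lo + suc μ → p i ~ p j ⇔ Consecutive i j)
    (sel : List ℕ) (sel-unique : Unique sel) (sel-length : length sel ≡ h)
    (lo∈ : lo ∈ˡ sel) (hi∈ : lo + suc μ ∈ˡ sel)
    (sel-range : ∀ {k} → k ∈ˡ sel → lo ≤ k × k ≤ lo + suc μ)
    (legs : ∀ {k} → k ∈ˡ sel → Leg p lo (lo + suc μ) Foot k)
    (apart : ∀ {k k′} (k∈ : k ∈ˡ sel) (k′∈ : k′ ∈ˡ sel) → k ≢ k′ → Apart (legs k∈) (legs k′∈)) where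

    private
      hi : ℕ
      hi = lo + suc μ
      m : ℕ
      m = suc (suc μ)

      Row : ℕ → Set
      Row k = Dec (k ∈ˡ sel)

      len : ∀ {k} → Row k → ℕ
      len (yes k∈) = suc (Leg.t (legs k∈))
      len (no _) = 0

      row : ∀ k → Row k
      row k = k ∈ℕ? sel

      vertex : ∀ k → Row k → ℕ → V
      vertex k _ zero = p k
      vertex k (yes k∈) (suc j) = Leg.y (legs k∈) j
      -- A default outside all valid cells, because an unselected row has length 0.
      vertex k (no _) (suc j) = p k

      ℓ : ℕ → ℕ
      ℓ i = len (row (lo + i))

      g : ℕ × ℕ → V
      g (i , j) = vertex (lo + i) (row (lo + i)) j

      InRange : ℕ → Set
      InRange k = lo ≤ k × k ≤ hi

      in-range : ∀ {i} → i < m → InRange (lo + i)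
      in-range {i} (s≤s i≤) = m≤m+n lo i , +-monoʳ-≤ lo i≤

      -- The adjacency of g w and g w′, read off the two cells.
      Shape : ℕ × ℕ → ℕ × ℕ → Set
      Shape (k , zero) (k′ , zero) = Consecutive k k′
      Shape (k , zero) (k′ , suc j′) = j′ ≡ 0 × Foot k′ k
      Shape (k , suc j) (k′ , zero) = j ≡ 0 × Foot k k′
      Shape (k , suc j) (k′ , suc j′) = k ≡ k′ × Consecutive j j′

      -- A leg depends on the membership proof stored in the decision about its row. The last
      -- hypothesis says that decisions about one row coincide; without it two vertices of one row
      -- could come from different legs.
      vertex-adj : ∀ {k k′} → InRange k → InRange k′ → (d : Row k) (d′ : Row k′) →
        ∀ {j j′} → j ≤ len d → j′ ≤ len d′ → (∀ (eq : k ≡ k′) → subst Row eq d ≡ d′) →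
        vertex k d j ~ vertex k′ d′ j′ ⇔ Shape (k , j) (k′ , j′)
      vertex-adj (a , b) (a′ , b′) d d′ {zero} {zero} _ _ _ = p-adj a b a′ b′
      vertex-adj r (a′ , b′) (yes k∈) d′ {suc j} {zero} (s≤s j≤) _ _ = Leg.foot (legs k∈) j≤ a′ b′
      vertex-adj (a , b) r′ d (yes k∈) {zero} {suc j} _ (s≤s j≤) _ =
        mk⇔ (to (Leg.foot (legs k∈) j≤ a b) ∘ ~-sym) (~-sym ∘ from (Leg.foot (legs k∈) j≤ a b))
      vertex-adj {k} {k′} _ _ (yes k∈) (yes k′∈) {suc j} {suc j′} (s≤s j≤) (s≤s j′≤) same with k ≟ k′
      ... | no k≢ = mk⇔ (λ e → ⊥-elim (Apart.y≁ (apart k∈ k′∈ k≢) j≤ j′≤ e)) (λ { (eq , _) → ⊥-elim (k≢ eq) })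
      ... | yes refl with same refl
      ...   | refl = mk⇔ (λ e → refl , to (Leg.y-adj (legs k∈) j≤ j′≤) e) (λ { (_ , c) → from (Leg.y-adj (legs k∈) j≤ j′≤) c })

      vertex-inj : ∀ {k k′} → InRange k → InRange k′ → (d : Row k) (d′ : Row k′) →
        ∀ {j j′} → j ≤ len d → j′ ≤ len d′ → (∀ (eq : k ≡ k′) → subst Row eq d ≡ d′) →
        vertex k d j ≡ vertex k′ d′ j′ → k ≡ k′ × j ≡ j′
      vertex-inj (a , b) (a′ , b′) d d′ {zero} {zero} _ _ _ eq = p-inj a b a′ b′ eq , refl
      vertex-inj r (a′ , b′) (yes k∈) d′ {suc j} {zero} (s≤s j≤) _ _ eq = ⊥-elim (Leg.y-spine (legs k∈) j≤ a′ b′ eq)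
      vertex-inj (a , b) r′ d (yes k∈) {zero} {suc j} _ (s≤s j≤) _ eq = ⊥-elim (Leg.y-spine (legs k∈) j≤ a b (≡-sym eq))
      vertex-inj {k} {k′} _ _ (yes k∈) (yes k′∈) {suc j} {suc j′} (s≤s j≤) (s≤s j′≤) same eq with k ≟ k′
      ... | no k≢ = ⊥-elim (Apart.y≢ (apart k∈ k′∈ k≢) j≤ j′≤ eq)
      ... | yes refl with same refl
      ...   | refl = refl , cong suc (Leg.y-inj (legs k∈) j≤ j′≤ eq)

      same-row : ∀ {k k′} (eq : k ≡ k′) → subst Row eq (row k) ≡ row k′
      same-row refl = refl

      g-adj : ∀ {i j i′ j′} → Cell m ℓ (i , j) → Cell m ℓ (i′ , j′) →
        g (i , j) ~ g (i′ , j′) ⇔ Shape (lo + i , j) (lo + i′ , j′)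
      g-adj (i< , j≤) (i′< , j′≤) =
        vertex-adj (in-range i<) (in-range i′<) (row _) (row _) j≤ j′≤ same-row

      g-inj : ∀ w w′ → Cell m ℓ w → Cell m ℓ w′ → g w ≡ g w′ → w ≡ w′
      g-inj (i , j) (i′ , j′) (i< , j≤) (i′< , j′≤) eq
        with vertex-inj (in-range i<) (in-range i′<) (row _) (row _) j≤ j′≤ same-row eq
      ... | eqk , eqj = cong₂ _,_ (+-cancelˡ-≡ lo i i′ eqk) eqj

      vertex∉ : ∀ {k} → InRange k → (d : Row k) → ∀ {j} → j ≤ len d → vertex k d j ∉ S
      vertex∉ (a , b) d {zero} _ = p∉ a b
      vertex∉ r (yes k∈) {suc j} (s≤s j≤) = Leg.y∉ (legs k∈) j≤

      g∉ : ∀ w → Cell m ℓ w → g w ∉ S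
      g∉ (i , j) (i< , j≤) = vertex∉ (in-range i<) (row _) j≤

      -- The membership proof by which the row k was built.
      canonical : ∀ {k} → k ∈ˡ sel → Σ (k ∈ˡ sel) λ k∈ → row k ≡ yes k∈
      canonical {k} k∈ with row k
      ... | yes k∈′ = k∈′ , refl
      ... | no k∉ = ⊥-elim (k∉ k∈)

      len-pos : ∀ {k} → k ∈ˡ sel → 0 < len (row k)
      len-pos k∈ with canonical k∈
      ... | _ , eq rewrite eq = s≤s z≤n

      len-pos⁻ : ∀ {k} → 0 < len (row k) → k ∈ˡ sel
      len-pos⁻ {k} 0< with row k
      ... | yes k∈ = k∈

      offset : ∀ {k} → InRange k → ∃[ i ] (lo + i ≡ k × i < m)
      offset {k} (a , b) = k ∸ lo , m+[n∸m]≡n a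
        , s≤s (≤-trans (∸-monoˡ-≤ lo b) (≤-reflexive (m+n∸m≡n lo (suc μ))))

      term : ∀ {k} → k ∈ˡ sel → V
      term k∈ = Leg.s (legs (proj₁ (canonical k∈)))

      vertex-near : ∀ {k k′} (k∈ : k ∈ˡ sel) → InRange k′ → (d : Row k′) → (∀ (eq : k ≡ k′) → subst Row eq (yes k∈) ≡ d) →
        ∀ {j} → j ≤ len d → Leg.s (legs k∈) ~ vertex k′ d j ⇔ (k ≡ k′ × 0 < j × j ≡ len d)
      vertex-near k∈ (a , b) d same {zero} _ = mk⇔ (λ e → ⊥-elim (Leg.s-spine (legs k∈) a b e)) (λ { (_ , () , _) })
      vertex-near {k} {k′} k∈ r (yes k′∈) same {suc j} (s≤s j≤) with k ≟ k′
      ... | no k≢ = mk⇔ (λ e → ⊥-elim (Apart.s≁ (apart k∈ k′∈ k≢) j≤ e)) (λ { (eq , _) → ⊥-elim (k≢ eq) })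
      ... | yes refl with same refl
      ...   | refl = mk⇔ (λ e → refl , s≤s z≤n , cong suc (to (Leg.s-tip (legs k∈) j≤) e))
                         (λ { (_ , _ , eq) → from (Leg.s-tip (legs k∈) j≤) (suc-injective eq) })

      near : ∀ {k i j} (k∈ : k ∈ˡ sel) → Cell m ℓ (i , j) → term k∈ ~ g (i , j) ⇔ (lo + i ≡ k × LegEnd ℓ (i , j))
      near {k} {i} {j} k∈ (i< , j≤) =
        mk⇔ (λ e → let eq , end = to N e in ≡-sym eq , end) (λ { (eq , end) → from N (≡-sym eq , end) })
        where
        N = vertex-near (proj₁ (canonical k∈)) (in-range i<) (row (lo + i))
              (λ { refl → ≡-sym (proj₂ (canonical k∈)) }) j≤

    module Finish (Valid : ℕ × ℕ → Set) (Adj : ℕ × ℕ → ℕ × ℕ → Set) (Valid⇒Cell : ∀ w → Valid w → Cell m ℓ w)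
      (tip-valid : ∀ i → i < m → 0 < ℓ i → Valid (i , ℓ i))
      {N : ℕ} (co : Fin N → ℕ × ℕ)
      (C : Coordinates (induced G N (g ∘ co)) Valid Adj) (co≗ : ∀ u → Coordinates.co C u ≡ co u)
      (simp : ∀ u → Simplicial (induced G N (g ∘ co)) u ⇔ LegEnd ℓ (Coordinates.co C u))
      (shape : Caterpillar (induced G N (g ∘ co)) ⊎ IsLineGraphOfCaterpillar (induced G N (g ∘ co))
                 ⊎ IsSubdividedStar (induced G N (g ∘ co))) where

      private
        Tip : ℕ → Fin N → Set
        Tip k u = lo + proj₁ (co u) ≡ k × LegEnd ℓ (co u)

        co-Cell : ∀ u → Cell m ℓ (co u)
        co-Cell u = subst (Cell m ℓ) (co≗ u) (Valid⇒Cell _ (Coordinates.valid C u))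

        co-inj : ∀ u v → co u ≡ co v → u ≡ v
        co-inj u v eq = Coordinates.inj C u v (trans (co≗ u) (trans eq (≡-sym (co≗ v))))

        tip : ∀ {k} → k ∈ˡ sel → ∃[ u ] Tip k u
        tip k∈ with offset (sel-range k∈)
        ... | i , refl , i< with Coordinates.vertex C (i , ℓ i) (tip-valid i i< (len-pos k∈))
        ...   | u , eq with trans (≡-sym (co≗ u)) eq
        ...     | eq′ = u , cong (λ w → lo + proj₁ w) eq′ , subst (LegEnd ℓ) (≡-sym eq′) (len-pos k∈ , refl)

        tip-unique : ∀ {k u v} → Tip k u → Tip k v → u ≡ v
        tip-unique {u = u} {v} (eq , _ , e) (eq′ , _ , e′) = co-inj u v (cong₂ _,_ i≡ (trans e (trans (cong ℓ i≡) (≡-sym e′))))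
          where
          i≡ : proj₁ (co u) ≡ proj₁ (co v)
          i≡ = +-cancelˡ-≡ lo _ _ (trans eq (≡-sym eq′))

      conclusion : Conclusion h G S
      conclusion = attached-conclusion
        (λ u v eq → co-inj u v (g-inj (co u) (co v) (co-Cell u) (co-Cell v) eq))
        (λ u → g∉ (co u) (co-Cell u)) shape sel sel-unique sel-length
        term (λ k∈ → Leg.s∈ (legs (proj₁ (canonical k∈)))) Tip tip tip-unique
        (λ { (eq , _) (eq′ , _) → trans (≡-sym eq) eq′ })
        (λ k∈ u → near k∈ (co-Cell u))
        λ u → mk⇔
          (λ sc → let end = subst (LegEnd ℓ) (co≗ u) (to (simp u) sc)
                  in lo + proj₁ (co u) , len-pos⁻ (subst (0 <_) (proj₂ end) (proj₁ end)) , refl , end)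
          (λ { (_ , _ , _ , end) → from (simp u) (subst (LegEnd ℓ) (≡-sym (co≗ u)) end) })

    private
      first : 0 < ℓ 0
      first = len-pos (subst (_∈ˡ sel) (≡-sym (+-identityʳ lo)) lo∈)

      last : 0 < ℓ (suc μ)
      last = len-pos hi∈

      lo+-consecutive : ∀ {i j} → Consecutive (lo + i) (lo + j) ⇔ Consecutive i j
      lo+-consecutive {i} {j} = mk⇔
        (λ { (inj₁ eq) → inj₁ (+-cancelˡ-≡ lo _ _ (trans (+-suc lo i) eq))
           ; (inj₂ eq) → inj₂ (+-cancelˡ-≡ lo _ _ (trans (+-suc lo j) eq)) })
        (λ { (inj₁ refl) → inj₁ (≡-sym (+-suc lo i)) ; (inj₂ refl) → inj₂ (≡-sym (+-suc lo j)) })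

    module _ (Foot⇔ : ∀ {k i} → Foot k i ⇔ (i ≡ k)) where

      private
        Shape⇔CombAdj : ∀ w w′ → Shape (lo + proj₁ w , proj₂ w) (lo + proj₁ w′ , proj₂ w′) ⇔ CombAdj w w′
        Shape⇔CombAdj (i , zero) (i′ , zero) = mk⇔
          (λ c → back (to lo+-consecutive c))
          (λ { (inj₁ spine) → from lo+-consecutive (inj₁ refl) ; (inj₂ spine) → from lo+-consecutive (inj₂ refl) })
          where
          back : Consecutive i i′ → CombAdj (i , 0) (i′ , 0)
          back (inj₁ refl) = inj₁ spine
          back (inj₂ refl) = inj₂ spine
        Shape⇔CombAdj (i , zero) (i′ , suc j′) = mk⇔
          (λ { (refl , ft) → back (+-cancelˡ-≡ lo _ _ (to Foot⇔ ft)) })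
          (λ { (inj₁ leg) → refl , from Foot⇔ refl ; (inj₂ ()) })
          where
          back : i ≡ i′ → CombAdj (i , 0) (i′ , 1)
          back refl = inj₁ leg
        Shape⇔CombAdj (i , suc j) (i′ , zero) = mk⇔
          (λ { (refl , ft) → back (+-cancelˡ-≡ lo _ _ (to Foot⇔ ft)) })
          (λ { (inj₂ leg) → refl , from Foot⇔ refl ; (inj₁ ()) })
          where
          back : i′ ≡ i → CombAdj (i , 1) (i′ , 0)
          back refl = inj₂ leg
        Shape⇔CombAdj (i , suc j) (i′ , suc j′) = mk⇔
          (λ { (eq , c) → back (+-cancelˡ-≡ lo _ _ eq) c })
          (λ { (inj₁ leg) → refl , inj₁ refl ; (inj₂ leg) → refl , inj₂ refl })
          where
          back : i ≡ i′ → Consecutive j j′ → CombAdj (i , suc j) (i′ , suc j′)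
          back refl (inj₁ refl) = inj₁ leg
          back refl (inj₂ refl) = inj₂ leg

        coordinates : Coordinates (induced G (total m ℓ) (g ∘ cell m ℓ)) (Cell m ℓ) CombAdj
        coordinates = record
          { co = cell m ℓ ; inj = cell-injective m ℓ ; valid = cell-Cell m ℓ ; vertex = cell-at m ℓ
          ; adj⇔ = λ u v → let E = g-adj (cell-Cell m ℓ u) (cell-Cell m ℓ v) ; E′ = Shape⇔CombAdj (cell m ℓ u) (cell m ℓ v)
                           in mk⇔ (to E′ ∘ to E) (from E ∘ from E′) }

      caterpillar-conclusion : Conclusion h G S
      caterpillar-conclusion = Finish.conclusion (Cell m ℓ) CombAdj (λ _ c → c) (λ i i< _ → i< , ≤-refl)
        (cell m ℓ) coordinates (λ _ → refl)
        (simplicial⇔LegEnd ℓ coordinates (comb-ends first last) (comb-others first last))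
        (inj₁ (comb-caterpillar (s≤s z≤n) coordinates))

    module _ (Foot⇔ : ∀ {k i} → Foot k i ⇔ (i ≡ k ⊎ i ≡ suc k)) where

      private
        Shape⇔LineAdj : ∀ w w′ → Shape (lo + proj₁ w , proj₂ w) (lo + proj₁ w′ , proj₂ w′) ⇔ LineAdj w w′
        Shape⇔LineAdj (i , zero) (i′ , zero) = mk⇔
          (λ c → back (to lo+-consecutive c))
          (λ { (inj₁ (inj₁ spine)) → from lo+-consecutive (inj₁ refl) ; (inj₁ (inj₂ spine)) → from lo+-consecutive (inj₂ refl)
             ; (inj₂ (inj₁ ())) ; (inj₂ (inj₂ ())) })
          where
          back : Consecutive i i′ → LineAdj (i , 0) (i′ , 0)
          back (inj₁ refl) = inj₁ (inj₁ spine)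
          back (inj₂ refl) = inj₁ (inj₂ spine)
        Shape⇔LineAdj (i , zero) (i′ , suc j′) = mk⇔
          (λ { (refl , ft) → back (to Foot⇔ ft) })
          (λ { (inj₁ (inj₁ leg)) → refl , from Foot⇔ (inj₁ refl) ; (inj₁ (inj₂ ()))
             ; (inj₂ (inj₁ ())) ; (inj₂ (inj₂ siblings)) → refl , from Foot⇔ (inj₂ (+-suc lo _)) })
          where
          back : lo + i ≡ lo + i′ ⊎ lo + i ≡ suc (lo + i′) → LineAdj (i , 0) (i′ , 1)
          back (inj₁ eq) with +-cancelˡ-≡ lo _ _ eq
          ... | refl = inj₁ (inj₁ leg)
          back (inj₂ eq) with +-cancelˡ-≡ lo _ _ (trans eq (≡-sym (+-suc lo i′)))
          ... | refl = inj₂ (inj₂ siblings)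
        Shape⇔LineAdj (i , suc j) (i′ , zero) = mk⇔
          (λ { (refl , ft) → back (to Foot⇔ ft) })
          (λ { (inj₁ (inj₂ leg)) → refl , from Foot⇔ (inj₁ refl) ; (inj₁ (inj₁ ()))
             ; (inj₂ (inj₂ ())) ; (inj₂ (inj₁ siblings)) → refl , from Foot⇔ (inj₂ (+-suc lo _)) })
          where
          back : lo + i′ ≡ lo + i ⊎ lo + i′ ≡ suc (lo + i) → LineAdj (i , 1) (i′ , 0)
          back (inj₁ eq) with +-cancelˡ-≡ lo _ _ eq
          ... | refl = inj₁ (inj₂ leg)
          back (inj₂ eq) with +-cancelˡ-≡ lo _ _ (trans eq (≡-sym (+-suc lo i)))
          ... | refl = inj₂ (inj₁ siblings)
        Shape⇔LineAdj (i , suc j) (i′ , suc j′) = mk⇔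
          (λ { (eq , c) → back (+-cancelˡ-≡ lo _ _ eq) c })
          (λ { (inj₁ (inj₁ leg)) → refl , inj₁ refl ; (inj₁ (inj₂ leg)) → refl , inj₂ refl
             ; (inj₂ (inj₁ ())) ; (inj₂ (inj₂ ())) })
          where
          back : i ≡ i′ → Consecutive j j′ → LineAdj (i , suc j) (i′ , suc j′)
          back refl (inj₁ refl) = inj₁ (inj₁ leg)
          back refl (inj₂ refl) = inj₁ (inj₂ leg)

        co : Fin (ℓ 0 + total (suc μ) (ℓ ∘ suc)) → ℕ × ℕ
        co u = cell m ℓ (suc u)

        adjacency : ∀ u v → g (co u) ~ g (co v) ⇔ LineAdj (co u) (co v)
        adjacency u v = let E = g-adj (cell-Cell m ℓ (suc u)) (cell-Cell m ℓ (suc v)) ; E′ = Shape⇔LineAdj (co u) (co v)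
                        in mk⇔ (to E′ ∘ to E) (from E ∘ from E′)

        nonroot-vertex : ∀ w → NonRoot m ℓ w → ∃[ u ] co u ≡ w
        nonroot-vertex w (c , ≢0) with cell-at m ℓ w c
        ... | zero , eq = ⊥-elim (≢0 (≡-sym eq))
        ... | suc u , eq = u , eq

        coordinates : Coordinates (induced G _ (g ∘ co)) (NonRoot m ℓ) LineAdj
        coordinates = record
          { co = co ; inj = λ u v eq → Fin.suc-injective (cell-injective m ℓ _ _ eq)
          ; valid = λ u → cell-Cell m ℓ (suc u) , λ eq → 0≢suc (cell-injective m ℓ (suc u) zero eq)
          ; vertex = nonroot-vertex ; adj⇔ = adjacency }
          where
          0≢suc : ∀ {k} {u : Fin k} → Data.Fin.suc u ≢ zero
          0≢suc ()

      -- The vertex `p lo` must be left out: its neighbours, the foot of the first leg and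
      -- `p (suc lo)`, are adjacent, so it would be simplicial without a neighbour among the chosen
      -- vertices of `S`. At the other end the foot of the last leg sees only `p hi`, the next
      -- vertex being beyond the spine.
      lineGraph-conclusion : Conclusion h G S
      lineGraph-conclusion = Finish.conclusion (NonRoot m ℓ) LineAdj (λ _ → proj₁)
        (λ i i< 0< → (i< , ≤-refl) , λ eq → <⇒≢ 0< (≡-sym (cong proj₂ eq)))
        co coordinates (λ _ → refl)
        (simplicial⇔LegEnd ℓ coordinates (line-ends first last) (line-others first last))
        (inj₂ (inj₁ (comb-lineGraph {G} (suc μ) ℓ (g ∘ co) adjacency)))

-- Small tools on finite families and increasing lists.

some-or-all : ∀ {k} {P Q : Fin k → Set} → (∀ i → P i ⊎ Q i) → (∃[ i ] P i) ⊎ (∀ i → Q i)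
some-or-all {zero} pq = inj₂ λ ()
some-or-all {suc k} pq with pq zero | some-or-all (pq ∘ suc)
... | inj₁ p | _ = inj₁ (zero , p)
... | inj₂ q | inj₁ (i , p) = inj₁ (suc i , p)
... | inj₂ q | inj₂ qs = inj₂ λ { zero → q ; (suc i) → qs i }

strict-bound : ∀ {k} (f : Fin k → ℕ) → ∃[ b ] (∀ i → f i < b)
strict-bound {zero} f = 0 , λ ()
strict-bound {suc k} f with argmax f
... | i , max = suc (f i) , λ j → s≤s (max j)

nth : ∀ {A : Set} → A → List A → ℕ → A
nth d [] i = d
nth d (x ∷ xs) zero = x
nth d (x ∷ xs) (suc i) = nth d xs i

All-nth : ∀ {A : Set} {P : A → Set} {d xs} → P d → All P xs → ∀ i → P (nth d xs i)
All-nth pd [] i = pd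
All-nth pd (p ∷ ps) zero = p
All-nth pd (p ∷ ps) (suc i) = All-nth pd ps i

AllPairs-nth : ∀ {A : Set} {R : A → A → Set} {d xs} → AllPairs R xs → ∀ {i j} → i < j → j < length xs → R (nth d xs i) (nth d xs j)
AllPairs-nth {d = d} {x ∷ xs} (r ∷ rs) {zero} {suc j} _ (s≤s j<) = head-nth r j<
  where
  head-nth : ∀ {P : _ → Set} {xs j} → All P xs → j < length xs → P (nth d xs j)
  head-nth {j = zero} (p ∷ ps) _ = p
  head-nth {j = suc j} (p ∷ ps) (s≤s j<) = head-nth ps j<
AllPairs-nth {xs = x ∷ xs} (r ∷ rs) {suc i} {suc j} (s≤s i<j) (s≤s j<) = AllPairs-nth rs i<j j<

-- The last index has the form `lo + suc μ`, so that a comb spanned by the list visibly has two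
-- different end rows.
span : ∀ {xs : List ℕ} → AllPairs _<_ xs → 2 ≤ length xs →
  ∃[ lo ] ∃[ μ ] (lo ∈ˡ xs × lo + suc μ ∈ˡ xs × (∀ {k} → k ∈ˡ xs → lo ≤ k × k ≤ lo + suc μ))
span {x ∷ []} _ (s≤s ())
span {x ∷ xs@(y ∷ ys)} (x< ∷ inc) _ with last y ys inc
  where
  last : ∀ y ys → AllPairs _<_ (y ∷ ys) → ∃[ z ] (z ∈ˡ y ∷ ys × (∀ {k} → k ∈ˡ y ∷ ys → k ≤ z))
  last y [] _ = y , here refl , λ { (here refl) → ≤-refl }
  last y (y′ ∷ ys) ((y<y′ ∷ _) ∷ inc) with last y′ ys inc
  ... | z , z∈ , max = z , there z∈ , λ { (here refl) → ≤-trans (<⇒≤ y<y′) (max (here refl)) ; (there k∈) → max k∈ }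
... | z , z∈ , max = x , z ∸ suc x , here refl , subst (_∈ˡ x ∷ xs) (≡-sym eq) (there z∈)
      , λ { (here refl) → ≤-refl , m≤m+n x _
          ; (there k∈) → <⇒≤ (All.lookup x< k∈) , ≤-trans (max k∈) (≤-reflexive (≡-sym eq)) }
  where
  eq : x + suc (z ∸ suc x) ≡ z
  eq = trans (+-suc x _) (m+[n∸m]≡n (All.lookup x< z∈))

-- Minimal connected sets that contain a neighbour of every vertex of `S`.

module Minimality (G : Graph) (S : Subset (n G)) where

  open Layers G

  Dominates : Subset (n G) → Set
  Dominates X = ∀ s → s ∈ S → ∃[ u ] (u ∈ X × s ~ u)

  dominates-or-not : ∀ X → Dominates X ⊎ (∃[ s ] (s ∈ S × (∀ u → u ∈ X → ¬ s ~ u)))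
  dominates-or-not X with Fin.any? (λ s → (s ∈? S) ×-dec ¬? (Fin.any? (λ u → (u ∈? X) ×-dec (s ~? u))))
  ... | yes (s , s∈ , none) = inj₂ (s , s∈ , λ u u∈ e → none (u , u∈ , e))
  ... | no all = inj₁ dom
    where
    dom : Dominates X
    dom s s∈ with Fin.any? (λ u → (u ∈? X) ×-dec (s ~? u))
    ... | yes found = found
    ... | no none = ⊥-elim (all (s , s∈ , none))

  record MinimalDominating (r : V) : Set where
    field
      H         : Subset (n G)
      r∈H       : r ∈ H
      H∉S       : ∀ {u} → u ∈ H → u ∉ S
      spans     : Spans H r
      dominates : Dominates H
      minimal   : ∀ v → v ∈ H → v ≢ r → Σ (Component (H - v) r) λ C →
                    ∃[ s ] (s ∈ S × (∀ u → u ∈ Component.set C → ¬ s ~ u))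

  -- Passing to the component of `r` after deleting `v` keeps the root and connectivity. Only
  -- domination can fail, and the `s` witnessing the failure is what `minimal` stores.
  shrink : ∀ r X → Acc _<_ ∣ X ∣ → r ∈ X → (∀ {u} → u ∈ X → u ∉ S) → Spans X r → Dominates X → MinimalDominating r
  shrink r X (acc rec) r∈ X∉ sp dom with some-or-all test
    where
    Removable Needed : V → Set
    Removable v = v ∈ X × Σ (Component (X - v) r) λ C → Dominates (Component.set C)
    Needed v = v ∈ X → v ≢ r → Σ (Component (X - v) r) λ C →
                 ∃[ s ] (s ∈ S × (∀ u → u ∈ Component.set C → ¬ s ~ u))
    test : ∀ v → Removable v ⊎ Needed v
    test v with v ∈? X | v Fin.≟ r
    ... | no v∉ | _ = inj₂ λ v∈ → ⊥-elim (v∉ v∈)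
    ... | yes _ | yes v≡r = inj₂ λ _ v≢r → ⊥-elim (v≢r v≡r)
    ... | yes v∈ | no v≢r with component (X - v) r (x∈p∧x≢y⇒x∈p-y r∈ (v≢r ∘ ≡-sym))
    ...   | C with dominates-or-not (Component.set C)
    ...     | inj₁ d = inj₁ (v∈ , C , d)
    ...     | inj₂ nd = inj₂ λ _ _ → C , nd
  ... | inj₂ needed = record
        { H = X ; r∈H = r∈ ; H∉S = X∉ ; spans = sp ; dominates = dom ; minimal = needed }
  ... | inj₁ (v , v∈ , C , d) =
        shrink r set (rec (≤-<-trans (p⊆q⇒∣p∣≤∣q∣ within) (x∈p⇒∣p-x∣<∣p∣ v∈))) root
          (X∉ ∘ x∈p-y⇒x∈p X v ∘ within) spans d
    where open Component C

-- Pendants and the subdivided star.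

module Main (h : ℕ) (3≤h : 3 ≤ h) (G : Graph) (noClique : ¬ HasCliqueOfSize G h) (S : Subset (n G))
  (r : Fin (n G)) (M : Minimality.MinimalDominating G S r) where

  open Layers G
  open Minimality.MinimalDominating M
  open Layering H r r∈H spans
  open Assembly h G S

  Goal : Set
  Goal = Conclusion h G S

  -- R is the component of r in H ∖ v, and s attaches to H only outside R;
  -- the path x leads from v to the first neighbour of s, outside R.
  record Pendant (v : V) : Set where
    field
      R      : Subset (n G)
      r∈R    : r ∈ R
      v∉R    : v ∉ R
      closed : ∀ {u w} → u ∈ R → u ~ w → w ∈ H → w ≢ v → w ∈ R
      rest   : ∀ {Y : Subset (n G)} → v ∈ Y → (∀ {u w} → u ∈ Y → u ~ w → w ∈ H → w ∉ R → w ∈ Y) →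
                 ∀ {u} → u ∈ H → u ∉ R → u ∈ Y
      t      : ℕ
      x      : ℕ → V
      x-zero : x 0 ≡ v
      x∈     : ∀ {i} → i ≤ t → x i ∈ H
      x∉R    : ∀ {i} → i ≤ t → x i ∉ R
      x-inj  : ∀ {i j} → i ≤ t → j ≤ t → x i ≡ x j → i ≡ j
      x-adj  : ∀ {i j} → i ≤ t → j ≤ t → x i ~ x j ⇔ Consecutive i j
      s      : V
      s∈     : s ∈ S
      s-tip  : ∀ {j} → j ≤ t → s ~ x j ⇔ (j ≡ t)
      s≁R    : ∀ {u} → u ∈ R → ¬ s ~ u

    x≁R : ∀ {i u} → suc i ≤ t → u ∈ R → ¬ x (suc i) ~ u
    x≁R i≤ u∈ e = x∉R i≤ (closed u∈ (~-sym e) (x∈ i≤)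
      λ eq → 1+n≢0 (x-inj i≤ z≤n (trans eq (≡-sym x-zero))))

  -- The set `D` is H minus the component of `r`. Since `s` has a neighbour in H but none in that
  -- component, it has one in `D`, and a shortest path in `D` from `v`, cut at its first neighbour
  -- of `s`, is the leg.
  pendant : ∀ {v} → v ∈ H → v ≢ r → Pendant v
  pendant {v} v∈ v≢r with minimal v v∈ v≢r
  ... | C , s , s∈ , s≁ = record
    { R = set ; r∈R = root ; v∉R = v∉ ; closed = λ u∈ e w∈ w≢v → C-closed u∈ e (x∈p∧x≢y⇒x∈p-y w∈ w≢v)
    ; rest = λ v∈Y cl u∈ u∉ → Reach-closed v∈Y (λ u∈Y e w∈D → cl u∈Y e (D⊆H w∈D) (D∉ w∈D))
               (proj₂ (D-spans _ (x∈p∩q⁺ (u∈ , x∉p⇒x∈∁p u∉))))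
    ; t = t ; x = x ; x-zero = x0 ; x∈ = D⊆H ∘ in-X ; x∉R = D∉ ∘ in-X
    ; x-inj = inj ; x-adj = λ i≤ j≤ → mk⇔ (adj⇒consecutive i≤ j≤) (consecutive⇒adj i≤ j≤)
    ; s = s ; s∈ = s∈ ; s-tip = λ {j} j≤ → mk⇔ (λ e → ≤-antisym j≤ (≮⇒≥ λ j< → before j j< e)) (λ { refl → hit })
    ; s≁R = s≁ _ }
    where
    open Component C using (set; root; within) renaming (closed to C-closed; spans to C-spans)
    v∉ : v ∉ set
    v∉ v∈C = x∉p-x H v (within v∈C)
    D : Subset (n G)
    D = H ∩ ∁ set
    D⊆H : ∀ {u} → u ∈ D → u ∈ H
    D⊆H = proj₁ ∘ x∈p∩q⁻ H (∁ set)
    D∉ : ∀ {u} → u ∈ D → u ∉ set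
    D∉ = x∈∁p⇒x∉p ∘ proj₂ ∘ x∈p∩q⁻ H (∁ set)
    v∈D : v ∈ D
    v∈D = x∈p∩q⁺ (v∈ , x∉p⇒x∈∁p v∉)
    -- A walk from `r` can leave the component only through `v`, so after its last exit it is a walk
    -- in `D` from `v`.
    sides : ∀ {k u} → Reach H r k u → u ∈ set ⊎ ∃[ k ] Reach D v k u
    sides (start _) = inj₁ root
    sides {u = w} (snoc ρ e w∈) with w ∈? set | sides ρ
    ... | yes w∈C | _ = inj₁ w∈C
    ... | no w∉C | inj₂ (_ , ρ′) = inj₂ (_ , snoc ρ′ e (x∈p∩q⁺ (w∈ , x∉p⇒x∈∁p w∉C)))
    ... | no w∉C | inj₁ u∈C with w Fin.≟ v
    ...   | yes refl = inj₂ (0 , start v∈D)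
    ...   | no w≢v = ⊥-elim (w∉C (C-closed u∈C e (x∈p∧x≢y⇒x∈p-y w∈ w≢v)))
    D-spans : Spans D v
    D-spans u u∈ with sides (proj₂ (spans u (D⊆H u∈)))
    ... | inj₁ u∈C = ⊥-elim (D∉ u∈ u∈C)
    ... | inj₂ ρ = ρ
    target : ∃[ u ] (u ∈ D × s ~ u)
    target with dominates s s∈
    ... | u , u∈ , e = u , x∈p∩q⁺ (u∈ , x∉p⇒x∈∁p λ u∈C → s≁ u u∈C e) , e
    module LD = Layering D v v∈D D-spans
    path = LD.first-hit (s ~?_) (proj₁ (proj₂ target)) (proj₂ (proj₂ target))
    x = proj₁ path
    t = proj₁ (proj₂ path)
    x0 = proj₁ (proj₂ (proj₂ path))
    open LD.Layered (proj₁ (proj₂ (proj₂ (proj₂ path))))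
    hit = proj₁ (proj₂ (proj₂ (proj₂ (proj₂ path))))
    before = proj₂ (proj₂ (proj₂ (proj₂ (proj₂ path))))

  path-in-R : ∀ {c} (P : Pendant c) {u} → u ∈ H → (∀ {i} → i ≤ depth u → ancestor u i ≢ c) →
    ∀ {i} → i ≤ depth u → ancestor u i ∈ Pendant.R P
  path-in-R P u∈ avoid {zero} i≤ = subst (_∈ Pendant.R P)
    (≡-sym (depth-zero (ancestor-∈ u∈ 0) (ancestor-depth u∈ z≤n))) (Pendant.r∈R P)
  path-in-R P u∈ avoid {suc i} i≤ = Pendant.closed P (path-in-R P u∈ avoid (<⇒≤ i≤))
    (ancestor-step u∈ i≤) (ancestor-∈ u∈ (suc i)) (avoid i≤)

  module Separated {c c′} (P : Pendant c) (P′ : Pendant c′) (c∈ : c ∈ Pendant.R P′) (c′∈ : c′ ∈ Pendant.R P) where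
    private
      module P = Pendant P
      module P′ = Pendant P′

    -- By `rest`, H minus `P.R` is connected from `c`. It contains `c`, which lies in `P′.R`, and
    -- avoids `c′`, the only vertex through which `P′.R` can be left; hence it stays inside `P′.R`.
    -- All separation of the two pendants follows from this inclusion and its mirror image.
    D⊆R′ : ∀ {u} → u ∈ H → u ∉ P.R → u ∈ P′.R
    D⊆R′ = P.rest c∈ λ u∈ e w∈ w∉ → P′.closed u∈ e w∈ λ { refl → w∉ c′∈ }

    D′⊆R : ∀ {u} → u ∈ H → u ∉ P′.R → u ∈ P.R
    D′⊆R = P′.rest c′∈ λ u∈ e w∈ w∉ → P.closed u∈ e w∈ λ { refl → w∉ c∈ }

    x≢x′ : ∀ {i j} → i ≤ P.t → j ≤ P′.t → P.x i ≢ P′.x j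
    x≢x′ i≤ j≤ eq = P′.x∉R j≤ (subst (_∈ P′.R) eq (D⊆R′ (P.x∈ i≤) (P.x∉R i≤)))

    x≁x′ : ¬ c ~ c′ → ∀ {i j} → i ≤ P.t → j ≤ P′.t → ¬ P.x i ~ P′.x j
    -- The first vertices are the only pair not separated by R.
    x≁x′ c≁c′ {zero} {zero} _ _ e = c≁c′ (subst₂ _~_ P.x-zero P′.x-zero e)
    x≁x′ c≁c′ {i} {suc j} i≤ j≤ e = P′.x≁R j≤ (D⊆R′ (P.x∈ i≤) (P.x∉R i≤)) (~-sym e)
    x≁x′ c≁c′ {suc i} {zero} i≤ j≤ e = P.x≁R i≤ (D′⊆R (P′.x∈ j≤) (P′.x∉R j≤)) e

    s≁x′ : ∀ {j} → j ≤ P′.t → ¬ P.s ~ P′.x j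
    s≁x′ j≤ = P.s≁R (D′⊆R (P′.x∈ j≤) (P′.x∉R j≤))

    s≢s′ : P.s ≢ P′.s
    s≢s′ eq = s≁x′ ≤-refl (subst (_~ P′.x P′.t) (≡-sym eq) (from (P′.s-tip ≤-refl) refl))

  Child : V → V → Set
  Child v c = c ∈ H × depth c ≡ suc (depth v) × parent c ≡ v

  child-adj : ∀ {v c} → Child v c → v ~ c
  child-adj (c∈ , d , refl) = proj₁ (proj₂ (parent-props c∈ d))

  child-pendant : ∀ {v c} → Child v c → Pendant c
  child-pendant (c∈ , d , _) = pendant c∈ λ { refl → 1+n≢0 (trans (≡-sym d) depth-root) }

  module Star (v : V) (v∈ : v ∈ H) (c : ℕ → V) (kid : ∀ i → Child v (c i))
    (c≢ : ∀ {i j} → i < h → j < h → i ≢ j → c i ≢ c j)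
    (c≁ : ∀ {i j} → i < h → j < h → i ≢ j → ¬ c i ~ c j)
    (P : ∀ i → Pendant (c i)) where

    ℓ : ℕ → ℕ
    ℓ i = Pendant.t (P i)
    g : ℕ × ℕ → V
    g (i , j) = Pendant.x (P i) j
    f : Fin (suc (total h ℓ)) → V
    f zero = v
    f (suc u) = g (cell h ℓ u)
    -- Every vertex on the root path of `v` has smaller depth than the child `c i`, so the path
    -- avoids `c i`.
    v∈R : ∀ i → v ∈ Pendant.R (P i)
    v∈R i = subst (_∈ Pendant.R (P i)) (ancestor-self ≤-refl)
      (path-in-R (P i) v∈ (λ {k} k≤ eq → <⇒≢ (s≤s k≤)
        (trans (≡-sym (ancestor-depth v∈ k≤)) (trans (cong depth eq) (proj₁ (proj₂ (kid i)))) )) ≤-refl)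
    c∈R : ∀ {i j} → i < h → j < h → i ≢ j → c i ∈ Pendant.R (P j)
    c∈R {i} {j} i< j< i≢j = Pendant.closed (P j) (v∈R j) (child-adj (kid i)) (proj₁ (kid i)) (c≢ i< j< i≢j)
    module Sep {i j} (i< : i < h) (j< : j < h) (i≢j : i ≢ j) =
      Separated (P i) (P j) (c∈R i< j< i≢j) (c∈R j< i< (i≢j ∘ ≡-sym))
    g-inj : ∀ w w′ → Cell h ℓ w → Cell h ℓ w′ → g w ≡ g w′ → w ≡ w′
    g-inj (i , j) (i′ , j′) (i< , j≤) (i′< , j′≤) eq with i ≟ i′
    ... | yes refl = cong (i ,_) (Pendant.x-inj (P i) j≤ j′≤ eq)
    ... | no i≢ = ⊥-elim (Sep.x≢x′ i< i′< i≢ j≤ j′≤ eq)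
    v≢g : ∀ w → Cell h ℓ w → v ≢ g w
    v≢g (i , j) (_ , j≤) eq = Pendant.x∉R (P i) j≤ (subst (_∈ Pendant.R (P i)) eq (v∈R i))
    f-inj : Injective f
    f-inj zero zero _ = refl
    f-inj zero (suc u) eq = ⊥-elim (v≢g (cell h ℓ u) (cell-Cell h ℓ u) eq)
    f-inj (suc u) zero eq = ⊥-elim (v≢g (cell h ℓ u) (cell-Cell h ℓ u) (≡-sym eq))
    f-inj (suc u) (suc u′) eq = cong suc (cell-injective h ℓ u u′
      (g-inj (cell h ℓ u) (cell h ℓ u′) (cell-Cell h ℓ u) (cell-Cell h ℓ u′) eq))
    f∉ : ∀ u → f u ∉ S
    f∉ zero = H∉S v∈
    f∉ (suc u) = H∉S (Pendant.x∈ (P (proj₁ (cell h ℓ u))) (proj₂ (cell-Cell h ℓ u)))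
    centre : ∀ w → Cell h ℓ w → v ~ g w ⇔ (proj₂ w ≡ 0)
    centre (i , zero) _ = mk⇔ (λ _ → refl) λ _ → subst (v ~_) (≡-sym (Pendant.x-zero (P i))) (child-adj (kid i))
    centre (i , suc j) (_ , j≤) = mk⇔ (λ e → ⊥-elim (Pendant.x≁R (P i) j≤ (v∈R i) (~-sym e))) λ ()
    LegAdj : ℕ × ℕ → ℕ × ℕ → Set
    LegAdj w w′ = proj₁ w ≡ proj₁ w′ × Consecutive (proj₂ w) (proj₂ w′)
    legs : ∀ w w′ → Cell h ℓ w → Cell h ℓ w′ → g w ~ g w′ ⇔ LegAdj w w′
    legs (i , j) (i′ , j′) (i< , j≤) (i′< , j′≤) with i ≟ i′
    ... | yes refl = mk⇔ (λ e → refl , to (Pendant.x-adj (P i) j≤ j′≤) e) (λ { (_ , k) → from (Pendant.x-adj (P i) j≤ j′≤) k })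
    ... | no i≢ = mk⇔ (λ e → ⊥-elim (Sep.x≁x′ i< i′< i≢ (c≁ i< i′< i≢) j≤ j′≤ e)) (λ { (eq , _) → ⊥-elim (i≢ eq) })
    star : IsSubdividedStar (induced G _ f)
    star = star-subdivided {G} h 3≤h ℓ f (λ u → centre (cell h ℓ u) (cell-Cell h ℓ u))
      (λ u u′ → legs (cell h ℓ u) (cell h ℓ u′) (cell-Cell h ℓ u) (cell-Cell h ℓ u′))
    Tip : ℕ → Fin (suc (total h ℓ)) → Set
    Tip i u = ∃[ u′ ] (u ≡ suc u′ × cell h ℓ u′ ≡ (i , ℓ i))
    near : ∀ {i} → i ∈ˡ upTo h → ∀ u → Pendant.s (P i) ~ f u ⇔ Tip i u
    near {i} _ zero = mk⇔ (λ e → ⊥-elim (Pendant.s≁R (P i) (v∈R i) e)) (λ { (_ , () , _) })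
    near {i} i∈ (suc u) = mk⇔ (λ e → u , refl , ⇒ (cell h ℓ u) (cell-Cell h ℓ u) e)
      (λ { (_ , refl , eq) → subst (λ w → Pendant.s (P i) ~ g w) (≡-sym eq) (from (Pendant.s-tip (P i) ≤-refl) refl) })
      where
      ⇒ : ∀ w → Cell h ℓ w → Pendant.s (P i) ~ g w → w ≡ (i , ℓ i)
      ⇒ (i′ , j) (i′< , j≤) e with i ≟ i′
      ... | yes refl = cong (i ,_) (to (Pendant.s-tip (P i) j≤) e)
      ... | no i≢ = ⊥-elim (Sep.s≁x′ (∈-upTo⁻ i∈) i′< i≢ j≤ e)
    simp : ∀ u → Simplicial (induced G (suc (total h ℓ)) f) u ⇔ (∃[ i ] (i ∈ˡ upTo h × Tip i u))
    simp u = mk⇔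
      (λ sc → let u′ , eq , end = to (starEnds u) sc
              in proj₁ (cell h ℓ u′) , ∈-upTo⁺ (proj₁ (cell-Cell h ℓ u′)) , u′ , eq , cong (proj₁ (cell h ℓ u′) ,_) end)
      (λ { (i , _ , u′ , eq , eq′) → from (starEnds u)
             (u′ , eq , trans (cong proj₂ eq′) (cong (ℓ ∘ proj₁) (≡-sym eq′))) })
      where
      starEnds = star-simplicial⇔ {G} (cell h ℓ) (cell-injective h ℓ) (cell-Cell h ℓ) (cell-at h ℓ) (<⇒≤ 3≤h) f
        (λ u → centre (cell h ℓ u) (cell-Cell h ℓ u))
        (λ u u′ → legs (cell h ℓ u) (cell h ℓ u′) (cell-Cell h ℓ u) (cell-Cell h ℓ u′))

    star-conclusion : Goal
    star-conclusion =
      attached-conclusion f-inj f∉ (inj₂ (inj₂ star)) (upTo h) (Unique.upTo⁺ h) (length-upTo h)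
        (λ {i} _ → Pendant.s (P i)) (λ {i} _ → Pendant.s∈ (P i)) Tip
        (λ {i} i∈ → let u , eq = cell-at h ℓ (i , ℓ i) (∈-upTo⁻ i∈ , ≤-refl) in suc u , u , refl , eq)
        (λ { (u , refl , eq) (u′ , refl , eq′) → cong suc (cell-injective h ℓ u u′ (trans eq (≡-sym eq′))) })
        (λ { (u , refl , eq) (_ , refl , eq′) → cong proj₁ (trans (≡-sym eq) eq′) })
      near simp

  stable-children⇒star : ∀ v → v ∈ H → ∀ cs → length cs ≡ h → All (Child v) cs → Unique cs →
    AllPairs (λ c c′ → ¬ c ~ c′) cs → Goal
  stable-children⇒star v v∈ [] len _ _ _ = ⊥-elim (<⇒≱ (s≤s z≤n) (subst (3 ≤_) (≡-sym len) 3≤h))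
  stable-children⇒star v v∈ cs@(c₀ ∷ _) len kids@(kid₀ ∷ _) uniq stable =
    Star.star-conclusion v v∈ (nth c₀ cs) kid
      (pairs (λ x≢y y≡x → x≢y (≡-sym y≡x)) uniq) (pairs (λ x≁y yx → x≁y (~-sym yx)) stable) (λ i → child-pendant (kid i))
    where
    kid : ∀ i → Child v (nth c₀ cs i)
    kid = All-nth kid₀ kids
    pairs : ∀ {R : V → V → Set} → (∀ {x y} → R x y → R y x) → AllPairs R cs → ∀ {i j} → i < h → j < h → i ≢ j → R (nth c₀ cs i) (nth c₀ cs j)
    pairs R-sym all {i} {j} i< j< i≢j with <-cmp i j
    ... | tri< i<j _ _ = AllPairs-nth all i<j (subst (j <_) (≡-sym len) j<)
    ... | tri≈ _ eq _ = ⊥-elim (i≢j eq)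
    ... | tri> _ _ j<i = R-sym (AllPairs-nth all j<i (subst (i <_) (≡-sym len) i<))

-- The summand `h` pays for vertices of `S` with contact at the current vertex. The product is the
-- pigeonhole number for the rest, sorted by child: it yields `ramsey h h` children, or one child
-- with enough left for `j` more events.
bound : ℕ → ℕ → ℕ
bound h zero = 0
bound h (suc j) = h + ramsey h h * suc (bound h j)

Gap : ℕ → ℕ → Set
Gap k k′ = suc k < k′ ⊎ suc k′ < k

-- The descent along the breadth-first tree.

module Descend (h : ℕ) (3≤h : 3 ≤ h) (G : Graph) (noClique : ¬ HasCliqueOfSize G h) (S : Subset (n G))
  (r : Fin (n G)) (M : Minimality.MinimalDominating G S r) where

  open Layers G
  open Minimality.MinimalDominating M
  open Layering H r r∈H spans
  open Assembly h G S
  open Main h 3≤h G noClique S r M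

  many-children⇒star : ∀ v → v ∈ H → ∀ cs → length cs ≡ ramsey h h → All (Child v) cs → Unique cs → Goal
  many-children⇒star v v∈ cs len kids uniq with ramsey-⊑ _~?_ h h cs (≤-reflexive (≡-sym len))
  ... | inj₂ (ys , ys⊑ , stable , len′) =
        stable-children⇒star v v∈ ys len′ (All-resp-⊆ ys⊑ kids) (AllPairs-⊑ ys⊑ uniq) stable
  ... | inj₁ (ys , ys⊑ , clique , len′) = ⊥-elim (noClique (subst (HasCliqueOfSize G) len′ (cliqueOf G clique)))

  -- A chosen neighbour in H, meaningful only on S.
  contact : V → V
  contact s with s ∈? S
  ... | yes s∈ = proj₁ (dominates s s∈)
  ... | no _ = r

  contact-∈ : ∀ s → contact s ∈ H
  contact-∈ s with s ∈? S
  ... | yes s∈ = proj₁ (proj₂ (dominates s s∈))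
  ... | no _ = r∈H

  contact-adj : ∀ {s} → s ∈ S → s ~ contact s
  contact-adj {s} s∈ with s ∈? S
  ... | yes s∈′ = proj₂ (proj₂ (dominates s s∈′))
  ... | no s∉ = ⊥-elim (s∉ s∈)

  -- The single vertex `v` is a path to which all of `ss` attach.
  common-contact⇒path : ∀ v → v ∈ H → ∀ ss → Unique ss → length ss ≡ h → All (_∈ S) ss → All (λ s → contact s ≡ v) ss → Goal
  common-contact⇒path v v∈ ss uniq len ss∈ at-v = path-conclusion (λ _ → v) 0 (λ _ → H∉S v∈)
    (λ { z≤n z≤n _ → refl }) (λ { z≤n z≤n → mk⇔ (λ e → ⊥-elim (~-irrefl e refl)) λ { (inj₁ ()) ; (inj₂ ()) } })
    ss uniq len ss∈
    (All.map (λ { (s∈ , refl) → 0 , z≤n , contact-adj s∈ }) (All.zip (ss∈ , at-v)))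

  Below : V → V → Set
  Below v s = s ∈ S × depth v ≤ depth (contact s) × ancestor (contact s) (depth v) ≡ v

  -- Phrased through the ancestors of `w` because the trunk is known only when the descent has
  -- reached its lower end; events are recorded on the way back.
  Event : V → ℕ → Set
  Event w k = (∃[ s ] (s ∈ S × contact s ≡ ancestor w k)) ⊎ (∃[ c ] (Child (ancestor w k) c × c ≢ ancestor w (suc k)))

  record Descent (v : V) (j : ℕ) : Set where
    field
      w      : V
      w∈     : w ∈ H
      deep   : depth v ≤ depth w
      w-below  : ancestor w (depth v) ≡ v
      ks     : List ℕ
      len    : length ks ≡ j
      inc    : AllPairs _<_ ks
      lower  : All (depth v ≤_) ks
      upper  : All (_< depth w) ks
      events : All (Event w) ks

  ascend : ∀ {v c j} → Child v c → Descent c j → Descent v j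
  ascend {v} {c} (_ , d , par) D = record
    { w = w ; w∈ = w∈ ; deep = <⇒≤ lt
    ; w-below = trans (≡-sym (ancestor-parent lt)) (trans (cong (parent ∘ ancestor w) (≡-sym d)) (trans (cong parent w-below) par))
    ; ks = ks ; len = len ; inc = inc ; lower = All.map (≤-trans (≤-trans (n≤1+n _) (≤-reflexive (≡-sym d)))) lower
    ; upper = upper ; events = events }
    where
    open Descent D
    lt : depth v < depth w
    lt = ≤-trans (≤-reflexive (≡-sym d)) deep

  record-event : ∀ {v c j} → Child v c → (D : Descent c j) → Event (Descent.w D) (depth v) → Descent v (suc j)
  record-event {v} kid@(_ , d , _) D e = record
    { w = w ; w∈ = w∈ ; deep = Descent.deep D′ ; w-below = Descent.w-below D′ ; ks = depth v ∷ ks ; len = cong suc len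
    ; inc = All.map (≤-trans (≤-reflexive (≡-sym d))) lower ∷ inc ; lower = ≤-refl ∷ Descent.lower D′
    ; upper = ≤-trans (≤-reflexive (≡-sym d)) deep ∷ upper ; events = e ∷ events }
    where
    open Descent D
    D′ = ascend kid D

  -- The next vertex on the way from v down to the contact of s, or v itself if v is that contact.
  toward : V → V → V
  toward v s = ancestor (contact s) (suc (depth v))

  Below-deeper : ∀ {v s} → Below v s → contact s ≢ v → depth v < depth (contact s)
  Below-deeper {v} {s} (_ , le , anc) ≢v = ≤∧≢⇒< le λ eq →
    ≢v (trans (≡-sym (ancestor-self {contact s} (≤-reflexive (≡-sym eq)))) anc)

  toward-Child : ∀ {v s} → Below v s → contact s ≢ v → Child v (toward v s)
  toward-Child {v} {s} b@(_ , _ , anc) ≢v = ancestor-∈ (contact-∈ s) (suc (depth v)) , ancestor-depth (contact-∈ s) lt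
    , trans (ancestor-parent lt) anc
    where
    lt = Below-deeper b ≢v

  toward-Below : ∀ {v s c} → Child v c → Below v s → toward v s ≡ c → Below c s
  toward-Below {v} {s} {c} (_ , d , _) (s∈ , _ , _) eq =
    s∈ , le , trans (cong (ancestor (contact s)) d) eq
    where
    le : depth c ≤ depth (contact s)
    le with depth c ≤? depth (contact s)
    ... | yes le = le
    -- If the contact is not as deep as `c`, then `toward` has returned the contact itself, which
    -- therefore equals `c`.
    ... | no ≰ = ≤-reflexive (cong depth (trans (≡-sym eq)
                   (ancestor-self {contact s} (≤-trans (<⇒≤ (≰⇒> ≰)) (≤-reflexive d)))))

  -- Either `j` drops because an event is recorded, or `A` is kept whole and only the depth grows.
  -- The second kind of step is limited by `fuel`, a bound on the depth still below `v`, so the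
  -- length of the trunk does not affect `bound`.
  descend : ∀ fuel j v → v ∈ H → (∀ u → depth u < depth v + fuel) → ∀ A → Unique A → All (Below v) A →
    suc (bound h j) ≤ length A → Goal ⊎ Descent v j
  descend zero j v v∈ fuel< A uniq bel big =
    -- Without fuel, `v` would be less deep than itself.
    ⊥-elim (<-irrefl refl (subst (depth v <_) (+-identityʳ _) (fuel< v)))
  descend (suc fuel) zero v v∈ fuel< A uniq bel big = inj₂ record
    { w = v ; w∈ = v∈ ; deep = ≤-refl ; w-below = ancestor-self {v} ≤-refl
    ; ks = [] ; len = refl ; inc = [] ; lower = [] ; upper = [] ; events = [] }
  descend (suc fuel) (suc j) v v∈ fuel< A uniq bel big
    with split {𝒫 = λ s → contact s ≡ v} h (ramsey h h * suc (bound h j)) A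
           (All.universal (λ s → toSum (contact s Fin.≟ v)) A) (<⇒≤ big)
  ... | inj₁ (ss , ss⊑ , at-v , len) = inj₁ (common-contact⇒path v v∈ ss (AllPairs-⊑ ss⊑ uniq) len
          (All-resp-⊆ ss⊑ (All.map proj₁ bel)) at-v)
  ... | inj₂ (B , B⊑ , off-v , len) with pigeonhole Fin._≟_ (toward v) (ramsey h h) (bound h j) B (≤-reflexive (≡-sym len))
  ...   | inj₁ (zs , zs∈ , distinct , len′) = inj₁ (many-children⇒star v v∈ (map (toward v) zs)
            (trans (length-map (toward v) zs) len′)
            (All-map⁺ (All.map (λ z∈ → toward-Child (All.lookup bel (⊑-∈ B⊑ z∈)) (All.lookup off-v z∈)) zs∈))
            (AllPairs-map⁺ distinct))
  ...   | inj₂ (z , z∈ , C , C⊑ , same , len′) with All.all? (λ s → toward v s Fin.≟ toward v z) A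
  -- This case includes no vertex with contact `v`, since `toward` returns `v` on those.
  ...     | yes all-same = Data.Sum.map₂ (ascend kid) (descend fuel (suc j) c (proj₁ kid) fuel′ A uniq
              (All.map (λ { (b , eq) → toward-Below kid b eq }) (All.zip (bel , all-same))) big)
    where
    c = toward v z
    kid : Child v c
    kid = toward-Child (All.lookup bel (⊑-∈ B⊑ z∈)) (All.lookup off-v z∈)
    fuel′ : ∀ u → depth u < depth c + fuel
    fuel′ u = subst (depth u <_) (trans (+-suc (depth v) fuel) (cong (_+ fuel) (≡-sym (proj₁ (proj₂ kid))))) (fuel< u)
  -- Some `s` does not follow the majority: its contact is `v`, or it lies below another child.
  -- Either is an event at `v`, and only the part `C` below the popular child is carried on.
  ...     | no ¬same with find (¬All⇒Any¬ (λ s → toward v s Fin.≟ toward v z) A ¬same)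
  ...       | s , s∈A , s≢ = Data.Sum.map₂ (λ D → record-event kid D (event D)) (descend fuel j c (proj₁ kid) fuel′ C
                (AllPairs-⊑ C⊑A uniq)
                (All.map (λ { (b , eq) → toward-Below kid b eq }) (All.zip (All-resp-⊆ C⊑A bel , same)))
                (≤-reflexive (≡-sym len′)))
    where
    c = toward v z
    C⊑A : C ⊑ A
    C⊑A = ⊆-trans C⊑ B⊑
    kid : Child v c
    kid = toward-Child (All.lookup bel (⊑-∈ B⊑ z∈)) (All.lookup off-v z∈)
    fuel′ : ∀ u → depth u < depth c + fuel
    fuel′ u = subst (depth u <_) (trans (+-suc (depth v) fuel) (cong (_+ fuel) (≡-sym (proj₁ (proj₂ kid))))) (fuel< u)
    event : (D : Descent c j) → Event (Descent.w D) (depth v)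
    event D with contact s Fin.≟ v
    ... | yes eq = inj₁ (s , proj₁ (All.lookup bel s∈A) , trans eq (≡-sym (Descent.w-below (ascend kid D))))
    ... | no ≢v = inj₂ (toward v s
                  , subst (λ x → Child x (toward v s)) (≡-sym (Descent.w-below (ascend kid D))) (toward-Child (All.lookup bel s∈A) ≢v)
                  , λ eq → s≢ (trans eq (trans (cong (ancestor (Descent.w D)) (≡-sym (proj₁ (proj₂ kid)))) (Descent.w-below D))))

  -- Branches along the trunk and the five behaviours.

  module Trunk (w : V) (w∈ : w ∈ H) where

    m : ℕ
    m = depth w

    v : ℕ → V
    v = ancestor w

    trunk : Layered v m
    trunk = ancestor-layered w∈

    record Branch (k : ℕ) : Set where
      field
        room : suc k < m
        c    : V
        kid  : Child (v k) c
        c≢   : c ≢ v (suc k)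
        P    : Pendant c

      k≤m : k ≤ m
      k≤m = <⇒≤ (<⇒≤ room)

      c-depth : depth c ≡ suc k
      c-depth = trans (proj₁ (proj₂ kid)) (cong suc (Layered.at trunk k≤m))

      v≢c : ∀ {i} → i ≤ m → v i ≢ c
      v≢c {i} i≤ eq with trans (≡-sym (Layered.at trunk i≤)) (trans (cong depth eq) c-depth)
      ... | refl = c≢ (≡-sym eq)

      v∈R : ∀ {i} → i ≤ m → v i ∈ Pendant.R P
      v∈R = path-in-R P w∈ v≢c

      near-trunk : ∀ {i} → i ≤ m → c ~ v i → i ≡ k ⊎ i ≡ suc k ⊎ i ≡ suc (suc k)
      near-trunk {i} i≤ e = close
        (≤-pred (subst₂ _≤_ c-depth (cong suc (Layered.at trunk i≤)) (depth-Lipschitz (Layered.in-X trunk i≤) (proj₁ kid) (~-sym e))))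
        (subst₂ _≤_ (Layered.at trunk i≤) (cong suc c-depth) (depth-Lipschitz (proj₁ kid) (Layered.in-X trunk i≤) e))
        where
        close : k ≤ i → i ≤ suc (suc k) → i ≡ k ⊎ i ≡ suc k ⊎ i ≡ suc (suc k)
        close k≤ i≤ with i ≟ k | i ≟ suc k
        ... | yes eq | _ = inj₁ eq
        ... | no _ | yes eq = inj₂ (inj₁ eq)
        ... | no i≢k | no i≢ = inj₂ (inj₂ (≤-antisym i≤ (≤∧≢⇒< (≤∧≢⇒< k≤ (i≢k ∘ ≡-sym)) (i≢ ∘ ≡-sym))))

    open Branch using (c; kid; P; c-depth; v∈R)

    c∈R : ∀ {k k′} (b : Branch k) (b′ : Branch k′) → k ≢ k′ → c b′ ∈ Pendant.R (P b)
    c∈R b b′ k≢ = Pendant.closed (P b) (v∈R b (Branch.k≤m b′)) (child-adj (kid b′)) (proj₁ (kid b′))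
      λ eq → k≢ (suc-injective (trans (≡-sym (c-depth b)) (trans (cong depth (≡-sym eq)) (c-depth b′))))

    -- Their depths `suc k` and `suc k′` differ by at least two.
    c≁c : ∀ {k k′} (b : Branch k) (b′ : Branch k′) → Gap k k′ → ¬ c b ~ c b′
    c≁c b b′ (inj₁ gap) e = <⇒≱ gap (≤-pred (subst₂ _≤_ (c-depth b′) (cong suc (c-depth b)) (depth-Lipschitz (proj₁ (kid b)) (proj₁ (kid b′)) e)))
    c≁c b b′ (inj₂ gap) e = <⇒≱ gap (≤-pred (subst₂ _≤_ (c-depth b) (cong suc (c-depth b′)) (depth-Lipschitz (proj₁ (kid b′)) (proj₁ (kid b)) (~-sym e))))

    module Apart² {k k′} (b : Branch k) (b′ : Branch k′) (k≢ : k ≢ k′) =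
      Separated (P b) (P b′) (c∈R b′ b (k≢ ∘ ≡-sym)) (c∈R b b′ k≢)

    module Selection (sel : List ℕ) (gaps : AllPairs (λ i j → suc i < j) sel) (len : length sel ≡ h) where

      sel-unique : Unique sel
      sel-unique = AllPairs.map (λ gap → <⇒≢ (<⇒≤ gap)) gaps

      sel-gap : ∀ {k k′} → k ∈ˡ sel → k′ ∈ˡ sel → k ≢ k′ → Gap k k′
      sel-gap = AllPairs-∈ swap (AllPairs.map inj₁ gaps)

      sel-span = span (AllPairs.map <⇒≤ gaps) (≤-trans (<⇒≤ 3≤h) (≤-reflexive (≡-sym len)))

      lo μ hi : ℕ
      lo = proj₁ sel-span
      μ = proj₁ (proj₂ sel-span)
      hi = lo + suc μ

      lo∈ : lo ∈ˡ sel
      lo∈ = proj₁ (proj₂ (proj₂ sel-span))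

      hi∈ : hi ∈ˡ sel
      hi∈ = proj₁ (proj₂ (proj₂ (proj₂ sel-span)))

      sel-range : ∀ {k} → k ∈ˡ sel → lo ≤ k × k ≤ hi
      sel-range = proj₂ (proj₂ (proj₂ (proj₂ sel-span)))

      module OnTrunk (B : ∀ {k} → k ∈ˡ sel → Branch k) (Foot : ℕ → ℕ → Set)
        (foot₀ : ∀ {k} (k∈ : k ∈ˡ sel) {i} → i ≤ m → c (B k∈) ~ v i ⇔ Foot k i) where

        below-m : ∀ {i} → i ≤ hi → i ≤ m
        below-m i≤ = ≤-trans i≤ (Branch.k≤m (B hi∈))

        leg-at : ∀ {k} (k∈ : k ∈ˡ sel) → Leg v lo hi Foot k
        leg-at k∈ = record
          { t = t ; y = x ; s = s ; s∈ = s∈ ; y∉ = H∉S ∘ x∈ ; y-inj = x-inj ; y-adj = x-adj ; s-tip = s-tip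
          ; s-spine = λ _ i≤ → s≁R (v∈R b (below-m i≤))
          ; foot = λ j≤ _ i≤ → foot j≤ (below-m i≤)
          ; y-spine = λ j≤ _ i≤ eq → x∉R j≤ (subst (_∈ R) (≡-sym eq) (v∈R b (below-m i≤))) }
          where
          b = B k∈
          open Pendant (P b)
          foot : ∀ {j i} → j ≤ t → i ≤ m → x j ~ v i ⇔ (j ≡ 0 × Foot _ i)
          foot {zero} {i} j≤ i≤ = mk⇔ (λ e → refl , to (foot₀ k∈ i≤) (subst (_~ v i) x-zero e))
            (λ { (_ , ft) → subst (_~ v i) (≡-sym x-zero) (from (foot₀ k∈ i≤) ft) })
          foot {suc j} j≤ i≤ = mk⇔ (λ e → ⊥-elim (x≁R j≤ (v∈R b i≤) e)) λ { (() , _) }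

        apart : ∀ {k k′} (k∈ : k ∈ˡ sel) (k′∈ : k′ ∈ˡ sel) → k ≢ k′ → Apart (leg-at k∈) (leg-at k′∈)
        apart k∈ k′∈ k≢ = record { y≢ = x≢x′ ; y≁ = x≁x′ (c≁c (B k∈) (B k′∈) (sel-gap k∈ k′∈ k≢)) ; s≁ = s≁x′ }
          where open Apart² (B k∈) (B k′∈) k≢

        module L = Legs {v} {lo} {μ} {Foot}
          (λ _ i≤ → H∉S (Layered.in-X trunk (below-m i≤)))
          (λ _ i≤ _ j≤ → Layered.inj trunk (below-m i≤) (below-m j≤))
          (λ _ i≤ _ j≤ → mk⇔ (Layered.adj⇒consecutive trunk (below-m i≤) (below-m j≤))
                             (Layered.consecutive⇒adj trunk (below-m i≤) (below-m j≤)))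
          sel sel-unique len lo∈ hi∈ sel-range leg-at apart

      claws⇒caterpillar : All (λ k → Σ (Branch k) λ b → ¬ c b ~ v (suc k) × ¬ c b ~ v (suc (suc k))) sel → Goal
      claws⇒caterpillar ts = OnTrunk.L.caterpillar-conclusion (λ k∈ → proj₁ (All.lookup ts k∈)) (λ k i → i ≡ k)
        (λ k∈ → foot₀ (All.lookup ts k∈)) (mk⇔ (λ eq → eq) (λ eq → eq))
        where
        foot₀ : ∀ {k} (t : Σ (Branch k) λ b → ¬ c b ~ v (suc k) × ¬ c b ~ v (suc (suc k))) {i} → i ≤ m → c (proj₁ t) ~ v i ⇔ (i ≡ k)
        foot₀ {k} (b , ≁₁ , ≁₂) {i} i≤ = mk⇔ ⇒ (λ { refl → ~-sym (child-adj (kid b)) })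
          where
          ⇒ : c b ~ v i → i ≡ k
          ⇒ e with Branch.near-trunk b i≤ e
          ... | inj₁ eq = eq
          ... | inj₂ (inj₁ refl) = ⊥-elim (≁₁ e)
          ... | inj₂ (inj₂ refl) = ⊥-elim (≁₂ e)

      triangles⇒lineGraph : All (λ k → Σ (Branch k) λ b → c b ~ v (suc k) × ¬ c b ~ v (suc (suc k))) sel → Goal
      triangles⇒lineGraph ts = OnTrunk.L.lineGraph-conclusion (λ k∈ → proj₁ (All.lookup ts k∈)) (λ k i → i ≡ k ⊎ i ≡ suc k)
        (λ k∈ → foot₀ (All.lookup ts k∈)) (mk⇔ (λ eq → eq) (λ eq → eq))
        where
        foot₀ : ∀ {k} (t : Σ (Branch k) λ b → c b ~ v (suc k) × ¬ c b ~ v (suc (suc k))) {i} → i ≤ m →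
          c (proj₁ t) ~ v i ⇔ (i ≡ k ⊎ i ≡ suc k)
        foot₀ {k} (b , ~₁ , ≁₂) {i} i≤ = mk⇔ ⇒ (λ { (inj₁ refl) → ~-sym (child-adj (kid b)) ; (inj₂ refl) → ~₁ })
          where
          ⇒ : c b ~ v i → i ≡ k ⊎ i ≡ suc k
          ⇒ e with Branch.near-trunk b i≤ e
          ... | inj₁ eq = inj₁ eq
          ... | inj₂ (inj₁ eq) = inj₂ eq
          ... | inj₂ (inj₂ refl) = ⊥-elim (≁₂ e)

      -- The whole trunk serves as the path. The vertices of `S` are distinct because their contacts
      -- have different depths.
      contacts⇒path : All (λ k → ∃[ s ] (s ∈ S × contact s ≡ v k × k ≤ m)) sel → Goal
      contacts⇒path ts = path-conclusion v m (H∉S ∘ Layered.in-X trunk) (Layered.inj trunk)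
        (λ i≤ j≤ → mk⇔ (Layered.adj⇒consecutive trunk i≤ j≤) (Layered.consecutive⇒adj trunk i≤ j≤))
        (collect proj₁ ts)
        (collect-Unique proj₁ (λ { k≢ (s , _ , eq , k≤) (s′ , _ , eq′ , k′≤) s≡ →
           k≢ (Layered.inj trunk k≤ k′≤ (trans (≡-sym eq) (trans (cong contact s≡) eq′))) }) sel-unique ts)
        (trans (collect-length proj₁ ts) len)
        (collect-All proj₁ (proj₁ ∘ proj₂) ts)
        (collect-All proj₁ (λ { {k} (s , s∈ , eq , k≤) → k , k≤ , subst (s ~_) eq (contact-adj s∈) }) ts)

      -- The trunk with v (suc k) replaced by the child c of v k for every selected k.
      module Rerouted (B : ∀ {k} → k ∈ˡ sel → Branch k) (skip : ∀ {k} (k∈ : k ∈ˡ sel) → c (B k∈) ~ v (suc (suc k))) where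

        pick : ∀ k → Dec (k ∈ˡ sel) → V
        pick k (yes k∈) = c (B k∈)
        pick k (no _) = v (suc k)

        q : ℕ → V
        q zero = v 0
        q (suc k) = pick k (k ∈ℕ? sel)

        canonical : ∀ {k} → k ∈ˡ sel → Σ (k ∈ˡ sel) λ k∈ → (k ∈ℕ? sel) ≡ yes k∈
        canonical {k} k∈ with k ∈ℕ? sel
        ... | yes k∈′ = k∈′ , refl
        ... | no k∉ = ⊥-elim (k∉ k∈)

        branch : ∀ {k} → k ∈ˡ sel → Branch k
        branch k∈ = B (proj₁ (canonical k∈))

        q-branch : ∀ {k} (k∈ : k ∈ˡ sel) → q (suc k) ≡ c (branch k∈)
        q-branch {k} k∈ = cong (pick k) (proj₂ (canonical k∈))

        step-to : ∀ k (d : Dec (k ∈ˡ sel)) → suc k ≤ m → v k ~ pick k d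
        step-to k (yes k∈) _ = child-adj (kid (B k∈))
        step-to k (no _) k< = Layered.next trunk k<

        -- The child `c` of `v k` has the depth of the vertex that it replaces, so only adjacency of
        -- consecutive vertices has to be verified.
        rerouted : Layered q m
        rerouted = record { in-X = in-X ; at = at ; next = next }
          where
          in-X : ∀ {i} → i ≤ m → q i ∈ H
          in-X {zero} i≤ = Layered.in-X trunk i≤
          in-X {suc k} i≤ with k ∈ℕ? sel
          ... | yes k∈ = proj₁ (kid (B k∈))
          ... | no _ = Layered.in-X trunk i≤
          at : ∀ {i} → i ≤ m → depth (q i) ≡ i
          at {zero} i≤ = Layered.at trunk i≤
          at {suc k} i≤ with k ∈ℕ? sel
          ... | yes k∈ = c-depth (B k∈)
          ... | no _ = Layered.at trunk i≤
          from-pick : ∀ k (d : Dec (k ∈ˡ sel)) (d′ : Dec (suc k ∈ˡ sel)) → suc (suc k) ≤ m → pick k d ~ pick (suc k) d′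
          from-pick k (yes k∈) (no _) _ = skip k∈
          from-pick k (no _) d′ k< = step-to (suc k) d′ k<
          -- Two replacements in a row are excluded by the gaps between selected indices.
          from-pick k (yes k∈) (yes k′∈) _ with sel-gap k∈ k′∈ (<⇒≢ ≤-refl)
          ... | inj₁ gap = ⊥-elim (<-irrefl refl gap)
          ... | inj₂ gap = ⊥-elim (<-asym gap (m≤n⇒m≤1+n ≤-refl))
          next : ∀ {i} → i < m → q i ~ q (suc i)
          next {zero} i< = step-to 0 (0 ∈ℕ? sel) i<
          next {suc k} i< = from-pick k (k ∈ℕ? sel) (suc k ∈ℕ? sel) i<

        -- Rerouting at other indices inserts only children that themselves lie in R of `b`, so the
        -- new path leaves R at most at index `suc k`, the place of the child of `b`.
        q∈R : ∀ {k} (b : Branch k) {i} → i ≤ m → i ≢ suc k → q i ∈ Pendant.R (P b)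
        q∈R b {zero} i≤ _ = v∈R b i≤
        q∈R b {suc i} i≤ i≢ with i ∈ℕ? sel
        ... | yes i∈ = c∈R b (B i∈) λ { refl → i≢ refl }
        ... | no _ = v∈R b i≤

        q-adj : ∀ {i j} → i ≤ m → j ≤ m → q i ~ q j ⇔ Consecutive i j
        q-adj i≤ j≤ = mk⇔ (Layered.adj⇒consecutive rerouted i≤ j≤) (Layered.consecutive⇒adj rerouted i≤ j≤)

        tips⇒path : (∀ {k} (k∈ : k ∈ˡ sel) → Pendant.t (P (B k∈)) ≡ 0) → Goal
        tips⇒path t≡0 = path-conclusion q m (H∉S ∘ Layered.in-X rerouted) (Layered.inj rerouted) q-adj
          (collect term members) (collect-Unique term apart sel-unique members) (trans (collect-length term members) len)
          (collect-All term (λ k∈ → Pendant.s∈ (P (branch k∈))) members) (collect-All term attached members)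
          where
          term : ∀ {k} → k ∈ˡ sel → V
          term k∈ = Pendant.s (P (branch k∈))
          members : All (_∈ˡ sel) sel
          members = All.tabulate (λ k∈ → k∈)
          apart : ∀ {k k′} → k ≢ k′ → (k∈ : k ∈ˡ sel) (k′∈ : k′ ∈ˡ sel) → term k∈ ≢ term k′∈
          apart k≢ k∈ k′∈ = Apart².s≢s′ (branch k∈) (branch k′∈) k≢
          attached : ∀ {k} (k∈ : k ∈ˡ sel) → ∃[ i ] (i ≤ m × term k∈ ~ q i)
          attached {k} k∈ = suc k , <⇒≤ (Branch.room (branch k∈)) , subst (term k∈ ~_) (trans x-zero (≡-sym (q-branch k∈)))
            (from (s-tip z≤n) (≡-sym (t≡0 _)))
            where open Pendant (P (branch k∈))

        -- The first vertex of each pendant now lies on the path, so the leg starts with the second,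
        -- which sees only that vertex of the path. The spine is shifted to `q ∘ suc` so that the
        -- child chosen at `k` has index `k`.
        long-legs⇒caterpillar : (∀ {k} (k∈ : k ∈ˡ sel) → ∃[ t ] (Pendant.t (P (B k∈)) ≡ suc t)) → Goal
        long-legs⇒caterpillar long = L.caterpillar-conclusion (mk⇔ (λ eq → eq) (λ eq → eq))
          where
          below-m : ∀ {i} → i ≤ hi → suc i ≤ m
          below-m i≤ = ≤-trans (s≤s i≤) (<⇒≤ (Branch.room (B hi∈)))

          shift : ∀ {i j} → Consecutive (suc i) (suc j) ⇔ Consecutive i j
          shift = mk⇔ (Data.Sum.map suc-injective suc-injective) (Data.Sum.map (cong suc) (cong suc))

          leg-at : ∀ {k} (k∈ : k ∈ˡ sel) → Leg (q ∘ suc) lo hi (λ k i → i ≡ k) k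
          leg-at {k} k∈ = record
            { t = t′ ; y = x ∘ suc ; s = s ; s∈ = s∈ ; y∉ = H∉S ∘ x∈ ∘ up≤
            ; y-inj = λ i≤ j≤ eq → suc-injective (x-inj (up≤ i≤) (up≤ j≤) eq)
            ; y-adj = λ i≤ j≤ → mk⇔ (to shift ∘ to (x-adj (up≤ i≤) (up≤ j≤))) (from (x-adj (up≤ i≤) (up≤ j≤)) ∘ from shift)
            ; s-tip = λ j≤ → mk⇔ (λ e → suc-injective (trans (to (s-tip (up≤ j≤)) e) t≡))
                                 (λ eq → from (s-tip (up≤ j≤)) (trans (cong suc eq) (≡-sym t≡)))
            ; s-spine = λ _ i≤ → s-spine i≤
            ; foot = λ j≤ _ i≤ → foot j≤ i≤
            ; y-spine = λ j≤ _ i≤ → y-spine j≤ i≤ }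
            where
            b = branch k∈
            open Pendant (P b)
            t′ = proj₁ (long (proj₁ (canonical k∈)))
            t≡ : t ≡ suc t′
            t≡ = proj₂ (long (proj₁ (canonical k∈)))
            up≤ : ∀ {j} → j ≤ t′ → suc j ≤ t
            up≤ j≤ = ≤-trans (s≤s j≤) (≤-reflexive (≡-sym t≡))
            q≡x₀ : q (suc k) ≡ x 0
            q≡x₀ = trans (q-branch k∈) (≡-sym x-zero)
            s-spine : ∀ {i} → i ≤ hi → ¬ s ~ q (suc i)
            s-spine {i} i≤ e with i ≟ k
            ... | yes refl = 0≢1+n (trans (to (s-tip z≤n) (subst (s ~_) q≡x₀ e)) t≡)
            ... | no i≢ = s≁R (q∈R b (below-m i≤) (i≢ ∘ suc-injective)) e
            foot : ∀ {j i} → j ≤ t′ → i ≤ hi → x (suc j) ~ q (suc i) ⇔ (j ≡ 0 × i ≡ k)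
            foot {j} {i} j≤ i≤ with i ≟ k
            ... | no i≢ = mk⇔ (λ e → ⊥-elim (x≁R (up≤ j≤) (q∈R b (below-m i≤) (i≢ ∘ suc-injective)) e)) (λ { (_ , eq) → ⊥-elim (i≢ eq) })
            ... | yes refl = mk⇔ (λ e → first (to (x-adj (up≤ j≤) z≤n) (subst (x (suc j) ~_) q≡x₀ e)) , refl)
                                 (λ { (refl , _) → subst (x 1 ~_) (≡-sym q≡x₀) (from (x-adj (up≤ j≤) z≤n) (inj₂ refl)) })
              where
              first : Consecutive (suc j) 0 → j ≡ 0
              first (inj₂ refl) = refl
            y-spine : ∀ {j i} → j ≤ t′ → i ≤ hi → x (suc j) ≢ q (suc i)
            y-spine {j} {i} j≤ i≤ eq with i ≟ k
            ... | yes refl = 1+n≢0 (x-inj (up≤ j≤) z≤n (trans eq q≡x₀))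
            ... | no i≢ = x∉R (up≤ j≤) (subst (_∈ R) (≡-sym eq) (q∈R b (below-m i≤) (i≢ ∘ suc-injective)))

          leg-≤ : ∀ {k} (k∈ : k ∈ˡ sel) {j} → j ≤ Leg.t (leg-at k∈) → suc j ≤ Pendant.t (P (branch k∈))
          leg-≤ k∈ j≤ = ≤-trans (s≤s j≤) (≤-reflexive (≡-sym (proj₂ (long (proj₁ (canonical k∈))))))

          apart : ∀ {k k′} (k∈ : k ∈ˡ sel) (k′∈ : k′ ∈ˡ sel) → k ≢ k′ → Apart (leg-at k∈) (leg-at k′∈)
          apart k∈ k′∈ k≢ = record
            { y≢ = λ i≤ j≤ → x≢x′ (leg-≤ k∈ i≤) (leg-≤ k′∈ j≤)
            ; y≁ = λ i≤ j≤ → x≁x′ (c≁c (branch k∈) (branch k′∈) (sel-gap k∈ k′∈ k≢)) (leg-≤ k∈ i≤) (leg-≤ k′∈ j≤)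
            ; s≁ = λ j≤ → s≁x′ (leg-≤ k′∈ j≤) }
            where open Apart² (branch k∈) (branch k′∈) k≢

          module L = Legs {q ∘ suc} {lo} {μ} {λ k i → i ≡ k}
            (λ _ i≤ → H∉S (Layered.in-X rerouted (below-m i≤)))
            (λ _ i≤ _ j≤ eq → suc-injective (Layered.inj rerouted (below-m i≤) (below-m j≤) eq))
            (λ _ i≤ _ j≤ → mk⇔ (to shift ∘ to (q-adj (below-m i≤) (below-m j≤))) (from (q-adj (below-m i≤) (below-m j≤)) ∘ from shift))
            sel sel-unique len lo∈ hi∈ sel-range leg-at apart

    Contact Claw Triangle TipDetour LongDetour : ℕ → Set
    Contact k = ∃[ s ] (s ∈ S × contact s ≡ v k × k ≤ m)
    Claw k = Σ (Branch k) λ b → ¬ c b ~ v (suc k) × ¬ c b ~ v (suc (suc k))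
    Triangle k = Σ (Branch k) λ b → c b ~ v (suc k) × ¬ c b ~ v (suc (suc k))
    TipDetour k = Σ (Branch k) λ b → c b ~ v (suc (suc k)) × Pendant.t (P b) ≡ 0
    LongDetour k = Σ (Branch k) λ b → c b ~ v (suc (suc k)) × ∃[ t ] (Pendant.t (P b) ≡ suc t)

    classify : ∀ {k} → suc k < m → Event w k → Contact k ⊎ Claw k ⊎ Triangle k ⊎ TipDetour k ⊎ LongDetour k
    classify room (inj₁ (s , s∈ , eq)) = inj₁ (s , s∈ , eq , <⇒≤ (<⇒≤ room))
    classify {k} room (inj₂ (c′ , kid′ , c≢)) = by-neighbours (c′ ~? v (suc k)) (c′ ~? v (suc (suc k)))
      where
      b : Branch k
      b = record { room = room ; c = c′ ; kid = kid′ ; c≢ = c≢ ; P = child-pendant kid′ }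
      detour : c′ ~ v (suc (suc k)) → ∀ t → Pendant.t (P b) ≡ t → TipDetour k ⊎ LongDetour k
      detour ~₂ zero eq = inj₁ (b , ~₂ , eq)
      detour ~₂ (suc t) eq = inj₂ (b , ~₂ , t , eq)
      by-neighbours : Dec (c′ ~ v (suc k)) → Dec (c′ ~ v (suc (suc k))) →
        Contact k ⊎ Claw k ⊎ Triangle k ⊎ TipDetour k ⊎ LongDetour k
      by-neighbours (no ≁₁) (no ≁₂) = inj₂ (inj₁ (b , ≁₁ , ≁₂))
      by-neighbours (yes ~₁) (no ≁₂) = inj₂ (inj₂ (inj₁ (b , ~₁ , ≁₂)))
      -- The detour drops `v (suc k)`, so both answers about that vertex lead here.
      by-neighbours _ (yes ~₂) = inj₂ (inj₂ (inj₂ (detour ~₂ (Pendant.t (P b)) refl)))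

    -- One summand `h` for each behaviour: successive applications of `split` find `h` events that
    -- behave alike.
    conclude : ∀ ks → AllPairs (λ i j → suc i < j) ks → All (λ k → suc k < m) ks → All (Event w) ks →
      length ks ≡ h + (h + (h + (h + h))) → Goal
    conclude ks gaps rooms events len
      with split h (h + (h + (h + h))) ks (All.map (λ { (room , e) → classify room e }) (All.zip (rooms , events))) (≤-reflexive (≡-sym len))
    ... | inj₁ (sel , s , ts , len₁) = Selection.contacts⇒path sel (AllPairs-⊑ s gaps) len₁ ts
    ... | inj₂ (ks₁ , s₁ , ts₁ , len₁) with split h (h + (h + h)) ks₁ ts₁ (≤-reflexive (≡-sym len₁))
    ...   | inj₁ (sel , s , ts , len′) = Selection.claws⇒caterpillar sel (AllPairs-⊑ (⊆-trans s s₁) gaps) len′ ts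
    ...   | inj₂ (ks₂ , s₂ , ts₂ , len₂) with split h (h + h) ks₂ ts₂ (≤-reflexive (≡-sym len₂))
    ...     | inj₁ (sel , s , ts , len′) = Selection.triangles⇒lineGraph sel (AllPairs-⊑ (⊆-trans s (⊆-trans s₂ s₁)) gaps) len′ ts
    ...     | inj₂ (ks₃ , s₃ , ts₃ , len₃) with split h h ks₃ ts₃ (≤-reflexive (≡-sym len₃))
    ...       | inj₁ (sel , s , ts , len′) =
                  Selection.Rerouted.tips⇒path sel (AllPairs-⊑ (⊆-trans s (⊆-trans s₃ (⊆-trans s₂ s₁))) gaps) len′
                    (λ k∈ → proj₁ (All.lookup ts k∈)) (λ k∈ → proj₁ (proj₂ (All.lookup ts k∈)))
                    (λ k∈ → proj₂ (proj₂ (All.lookup ts k∈)))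
    ...       | inj₂ (sel , s , ts , len′) =
                  Selection.Rerouted.long-legs⇒caterpillar sel (AllPairs-⊑ (⊆-trans s (⊆-trans s₃ (⊆-trans s₂ s₁))) gaps) len′
                    (λ k∈ → proj₁ (All.lookup ts k∈)) (λ k∈ → proj₁ (proj₂ (All.lookup ts k∈)))
                    (λ k∈ → proj₂ (proj₂ (All.lookup ts k∈)))

  conclusion : (∀ {A : List V} → Unique A → All (_∈ S) A →
    let N = h + (h + (h + (h + h))) in suc (bound h (N + N)) ≤ length A → Goal)
  conclusion {A} uniq A∈ big with strict-bound depth
  -- All of `S` lies below the root, so the descent starts there; `N + N` events leave `N` after
  -- `alternate`.
  ... | b , depth< with descend b (N + N) r r∈H (λ u → ≤-trans (depth< u) (m≤n+m b (depth r))) A uniq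
          (All.map (λ {s} s∈ → s∈ , ≤-trans (≤-reflexive depth-root) z≤n
             , trans (cong (ancestor (contact s)) depth-root)
                 (depth-zero (ancestor-∈ (contact-∈ s) 0) (ancestor-depth (contact-∈ s) z≤n))) A∈) big
    where N = h + (h + (h + (h + h)))
  ...   | inj₁ goal = goal
  ...   | inj₂ D = Trunk.conclude w w∈ (alternate ks) (alternate-gaps inc) (alternate-room inc upper)
            (All-resp-⊆ (alternate-⊑ ks) events) (length-alternate _ ks len)
    where open Descent D

theorem5p4 : ∀ (h' : ℕ) → 1 ≤ h' → ∃[ ν ] (1 ≤ ν ×
    (∀ (G : Graph) → Connected G → ¬ HasCliqueOfSize G h' →
    ∀ (S' : Subset (n G)) → ν ≤ ∣ S' ∣ → ConnectedOn G (∁ S') →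
    (∀ s → s ∈ S' → ∃[ u ] (u ∉ S' × Adjacent G s u)) →
    Σ (Subset (n G)) λ S̃ → S̃ ⊆ S' × ∣ S̃ ∣ ≡ h' ×
    (∃[ k ] Σ (Fin k → Fin (n G)) λ f → Injective f × (∀ i → f i ∉ S') ×
    Outcome G S̃ k f)))
theorem5p4 h 1≤h = ν , s≤s z≤n , λ G _ noClique S ν≤ conn attached →
  main G noClique S conn attached (elements S) (elements-unique S)
    (All.tabulate (∈-elements⁻ S)) (≤-trans ν≤ (∣p∣≤length-elements S))
  where
  N : ℕ
  N = h + (h + (h + (h + h)))
  ν : ℕ
  ν = suc (bound h (N + N))
  main : ∀ G → ¬ HasCliqueOfSize G h → ∀ S → ConnectedOn G (∁ S) →
    (∀ s → s ∈ S → ∃[ u ] (u ∉ S × Adjacent G s u)) →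
    ∀ A → Unique A → All (_∈ S) A → ν ≤ length A → Conclusion h G S
  -- As `ν` is positive, `S` has a member; any neighbour of it outside `S` can be the root.
  main G noClique S conn attached A@(s ∷ _) uniq A∈@(s∈ ∷ _) big with attached s s∈
  ... | r , r∉ , s~r = Descend.conclusion h (large h 1≤h noClique) G noClique S r
      (shrink r (∁ S) (<-wellFounded _) (x∉p⇒x∈∁p r∉) x∈∁p⇒x∉p
        (λ v v∈ → Walk⇒Reach (start (x∉p⇒x∈∁p r∉)) (conn r v (x∉p⇒x∈∁p r∉) v∈))
        (λ s s∈ → let u , u∉ , e = attached s s∈ in u , x∉p⇒x∈∁p u∉ , e))
      uniq A∈ big
    where
    open Layers G
    open Minimality G S
    -- The vertex `s` and the edge from `s` to `r` are cliques of sizes one and two. The resulting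
    -- `3 ≤ h` is what the star needs for its number of legs.
    large : ∀ h → 1 ≤ h → ¬ HasCliqueOfSize G h → 3 ≤ h
    large 1 _ noClique = ⊥-elim (noClique (cliqueOf G {s ∷ []} ([] ∷ [])))
    large 2 _ noClique = ⊥-elim (noClique (cliqueOf G {s ∷ r ∷ []} ((s~r ∷ []) ∷ [] ∷ [])))
    large (suc (suc (suc h))) _ _ = s≤s (s≤s (s≤s z≤n))
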